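{- Fix a standard $n\in\omega$. Let $M$ be a structure for the first-order language of arithmetic and let $A,B\subseteq M$ be such that $(M,A,B)\models\mathsf{B}\Sigma^0_{n+1}+\exp$ and $\Sigma_{n+1}$-induction with $A$ as parameter fails in $(M,A)$. If $B$ is arithmetically definable in $(M,A)$, then $B$ is $\Delta^0_{n+1}$-definable in $(M,A)$.
   Context: $(M,A,B)$ denotes $M$ expanded by unary predicates for $A$ and $B$. $\mathsf{B}\Sigma^0_{n+1}$ is the theory consisting of the basic axioms $P^-$ of arithmetic, $\Delta_0$-induction and the $\Sigma_{n+1}$-collection (bounding) scheme, for formulas in the language with the predicates; $\exp$ asserts totality of exponentiation. "Arithmetically definable in $(M,A)$" means definable over $(M,A)$ by some first-order formula (with number parameters and predicate $A$); "$\Delta^0_{n+1}$-definable in $(M,A)$" means definable over $(M,A)$ both by a $\Sigma_{n+1}$ and by a $\Pi_{n+1}$ formula in the language with predicate $A$ and number parameters. -}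

module Defs where

open import Data.Nat using (ℕ; zero; suc)
open import Data.Bool using (Bool; true; false)
open import Data.Unit using (⊤; tt)
open import Data.Empty using (⊥)
open import Data.Product using (Σ; _×_; _,_; ∃)
open import Data.Sum using (_⊎_)
open import Relation.Nullary using (¬_)
open import Relation.Binary.PropositionalEquality using (_≡_)

record Structure : Set₁ where
  field
    Carrier : Set
    𝟘 𝟙     : Carrier
    _⊕_ _⊗_ : Carrier → Carrier → Carrier
    _≺_     : Carrier → Carrier → Set

-- Syntax. Variables are de Bruijn indices (ℕ); formulas are
-- parametrised by a set P of unary predicate symbols
-- (P = ⊥ : pure arithmetic; P = ⊤ : predicate A; P = Bool : A and B).

data Term : Set where
  var       : ℕ → Term
  zeroᵗ oneᵗ : Term
  _+ᵗ_ _*ᵗ_ : Term → Term → Term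

data Formula (P : Set) : Set where
  _≐_ _<'_  : Term → Term → Formula P
  rel       : P → Term → Formula P
  ⊤' ⊥'     : Formula P
  ¬'_       : Formula P → Formula P
  _∧'_ _∨'_ _⇒'_ : Formula P → Formula P → Formula P
  ∀' ∃'     : Formula P → Formula P
  -- bounded quantifiers ∀x<t, ∃x<t (t is read in the outer context)
  ∀<' ∃<'   : Term → Formula P → Formula P

data IsΔ₀ {P : Set} : Formula P → Set where
  eq   : ∀ t s → IsΔ₀ (t ≐ s)
  lt   : ∀ t s → IsΔ₀ (t <' s)
  at   : ∀ p t → IsΔ₀ (rel p t)
  tru  : IsΔ₀ ⊤'
  fls  : IsΔ₀ ⊥'
  neg  : ∀ {φ} → IsΔ₀ φ → IsΔ₀ (¬' φ)
  conj : ∀ {φ ψ} → IsΔ₀ φ → IsΔ₀ ψ → IsΔ₀ (φ ∧' ψ)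
  disj : ∀ {φ ψ} → IsΔ₀ φ → IsΔ₀ ψ → IsΔ₀ (φ ∨' ψ)
  imp  : ∀ {φ ψ} → IsΔ₀ φ → IsΔ₀ ψ → IsΔ₀ (φ ⇒' ψ)
  ball : ∀ t {φ} → IsΔ₀ φ → IsΔ₀ (∀<' t φ)
  bex  : ∀ t {φ} → IsΔ₀ φ → IsΔ₀ (∃<' t φ)

data IsΣ {P : Set} : ℕ → Formula P → Set
data IsΠ {P : Set} : ℕ → Formula P → Set

data IsΣ {P} where
  Σ-Δ₀  : ∀ {k φ} → IsΔ₀ φ → IsΣ k φ
  Σ-∃Π  : ∀ {k φ} → IsΠ k φ → IsΣ (suc k) (∃' φ)
  Σ-∃Σ  : ∀ {k φ} → IsΣ (suc k) φ → IsΣ (suc k) (∃' φ)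

data IsΠ {P} where
  Π-Δ₀  : ∀ {k φ} → IsΔ₀ φ → IsΠ k φ
  Π-∀Σ  : ∀ {k φ} → IsΣ k φ → IsΠ (suc k) (∀' φ)
  Π-∀Π  : ∀ {k φ} → IsΠ (suc k) φ → IsΠ (suc k) (∀' φ)

-- Tarski semantics (Set-valued; classical when excluded middle holds).

module Semantics (𝕄 : Structure) where
  open Structure 𝕄

  Env : Set
  Env = ℕ → Carrier

  _∷ₑ_ : Carrier → Env → Env
  (m ∷ₑ ρ) zero    = m
  (m ∷ₑ ρ) (suc i) = ρ i

  ⟦_⟧ᵗ : Term → Env → Carrier
  ⟦ var i ⟧ᵗ ρ  = ρ i
  ⟦ zeroᵗ ⟧ᵗ ρ  = 𝟘
  ⟦ oneᵗ ⟧ᵗ ρ   = 𝟙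
  ⟦ t +ᵗ s ⟧ᵗ ρ = ⟦ t ⟧ᵗ ρ ⊕ ⟦ s ⟧ᵗ ρ
  ⟦ t *ᵗ s ⟧ᵗ ρ = ⟦ t ⟧ᵗ ρ ⊗ ⟦ s ⟧ᵗ ρ

  Sat : {P : Set} → (P → Carrier → Set) → Formula P → Env → Set
  Sat I (t ≐ s)    ρ = ⟦ t ⟧ᵗ ρ ≡ ⟦ s ⟧ᵗ ρ
  Sat I (t <' s)   ρ = ⟦ t ⟧ᵗ ρ ≺ ⟦ s ⟧ᵗ ρ
  Sat I (rel p t)  ρ = I p (⟦ t ⟧ᵗ ρ)
  Sat I ⊤'         ρ = ⊤
  Sat I ⊥'         ρ = ⊥
  Sat I (¬' φ)     ρ = ¬ Sat I φ ρ
  Sat I (φ ∧' ψ)   ρ = Sat I φ ρ × Sat I ψ ρ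
  Sat I (φ ∨' ψ)   ρ = Sat I φ ρ ⊎ Sat I ψ ρ
  Sat I (φ ⇒' ψ)   ρ = Sat I φ ρ → Sat I ψ ρ
  Sat I (∀' φ)     ρ = (m : Carrier) → Sat I φ (m ∷ₑ ρ)
  Sat I (∃' φ)     ρ = Σ Carrier λ m → Sat I φ (m ∷ₑ ρ)
  Sat I (∀<' t φ)  ρ = (m : Carrier) → m ≺ ⟦ t ⟧ᵗ ρ → Sat I φ (m ∷ₑ ρ)
  Sat I (∃<' t φ)  ρ = Σ Carrier λ m → m ≺ ⟦ t ⟧ᵗ ρ × Sat I φ (m ∷ₑ ρ)

  _↔_ : Set → Set → Set
  X ↔ Y = (X → Y) × (Y → X)

  noPred : ⊥ → Carrier → Set
  noPred ()

  predA : (Carrier → Set) → ⊤ → Carrier → Set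
  predA A _ = A

  predAB : (Carrier → Set) → (Carrier → Set) → Bool → Carrier → Set
  predAB A B true  = A
  predAB A B false = B

  -- P⁻ : axioms of the nonnegative part of a discretely ordered ring
  -- (Kaye, "Models of Peano Arithmetic", §2.1).
  record PMinus : Set where
    field
      +-assoc  : ∀ x y z → (x ⊕ y) ⊕ z ≡ x ⊕ (y ⊕ z)
      +-comm   : ∀ x y → x ⊕ y ≡ y ⊕ x
      *-assoc  : ∀ x y z → (x ⊗ y) ⊗ z ≡ x ⊗ (y ⊗ z)
      *-comm   : ∀ x y → x ⊗ y ≡ y ⊗ x
      distrib  : ∀ x y z → x ⊗ (y ⊕ z) ≡ (x ⊗ y) ⊕ (x ⊗ z)
      +-zero   : ∀ x → x ⊕ 𝟘 ≡ x
      *-zero   : ∀ x → x ⊗ 𝟘 ≡ 𝟘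
      *-one    : ∀ x → x ⊗ 𝟙 ≡ x
      <-irrefl : ∀ x → ¬ (x ≺ x)
      <-trans  : ∀ x y z → x ≺ y → y ≺ z → x ≺ z
      <-tri    : ∀ x y → (x ≺ y) ⊎ (x ≡ y) ⊎ (y ≺ x)
      +-mono   : ∀ x y z → x ≺ y → (x ⊕ z) ≺ (y ⊕ z)
      *-mono   : ∀ x y z → 𝟘 ≺ z → x ≺ y → (x ⊗ z) ≺ (y ⊗ z)
      sub      : ∀ x y → x ≺ y → Σ Carrier λ z → x ⊕ z ≡ y
      zero<one : 𝟘 ≺ 𝟙
      discrete : ∀ x → 𝟘 ≺ x → (𝟙 ≺ x) ⊎ (𝟙 ≡ x)
      nonneg   : ∀ x → (𝟘 ≺ x) ⊎ (𝟘 ≡ x)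

  InductionInstance : {P : Set} → (P → Carrier → Set) → Formula P → Env → Set
  InductionInstance I φ ρ =
    Sat I φ (𝟘 ∷ₑ ρ) →
    ((x : Carrier) → Sat I φ (x ∷ₑ ρ) → Sat I φ ((x ⊕ 𝟙) ∷ₑ ρ)) →
    (x : Carrier) → Sat I φ (x ∷ₑ ρ)

  CollectionInstance : {P : Set} → (P → Carrier → Set) → Formula P → Env → Set
  CollectionInstance I φ ρ = (a : Carrier) →
    ((x : Carrier) → x ≺ a → Σ Carrier λ y → Sat I φ (y ∷ₑ (x ∷ₑ ρ))) →
    Σ Carrier λ b → (x : Carrier) → x ≺ a →
      Σ Carrier λ y → y ≺ b × Sat I φ (y ∷ₑ (x ∷ₑ ρ))

  Δ₀-Ind : {P : Set} → (P → Carrier → Set) → Set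
  Δ₀-Ind {P} I = (φ : Formula P) → IsΔ₀ φ → (ρ : Env) → InductionInstance I φ ρ

  BΣ-scheme : {P : Set} → ℕ → (P → Carrier → Set) → Set
  BΣ-scheme {P} k I = (φ : Formula P) → IsΣ k φ → (ρ : Env) → CollectionInstance I φ ρ

  -- exp: exponentiation is total. Expressed via a Δ₀ formula E(x,y)
  -- (x = var 1, y = var 0) of pure arithmetic satisfying the recursion
  -- equations of y = 2^x in M and being total.
  Exp : Set
  Exp = Σ (Formula ⊥) λ E → IsΔ₀ E × Σ Env λ ρ →
      ((y : Carrier) → Sat noPred E (y ∷ₑ (𝟘 ∷ₑ ρ)) ↔ (y ≡ 𝟙))
    × ((x z : Carrier) → Sat noPred E (z ∷ₑ ((x ⊕ 𝟙) ∷ₑ ρ)) ↔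
          (Σ Carrier λ y → Sat noPred E (y ∷ₑ (x ∷ₑ ρ)) × (z ≡ y ⊕ y)))
    × ((x : Carrier) → Σ Carrier λ y → Sat noPred E (y ∷ₑ (x ∷ₑ ρ)))

  ModelsBΣ+exp : ℕ → (Carrier → Set) → (Carrier → Set) → Set
  ModelsBΣ+exp n A B =
    PMinus × Δ₀-Ind (predAB A B) × BΣ-scheme (suc n) (predAB A B) × Exp

  IΣ-fails : ℕ → (Carrier → Set) → Set
  IΣ-fails n A = Σ (Formula ⊤) λ φ → IsΣ (suc n) φ × Σ Env λ ρ →
    ¬ InductionInstance (predA A) φ ρ

  Defines : (Carrier → Set) → Formula ⊤ → Env → (Carrier → Set) → Set
  Defines A φ ρ B = (m : Carrier) → B m ↔ Sat (predA A) φ (m ∷ₑ ρ)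

  ArithDefinable : (Carrier → Set) → (Carrier → Set) → Set
  ArithDefinable A B = Σ (Formula ⊤) λ φ → Σ Env λ ρ → Defines A φ ρ B

  Δ⁰-Definable : ℕ → (Carrier → Set) → (Carrier → Set) → Set
  Δ⁰-Definable k A B =
      (Σ (Formula ⊤) λ σ → IsΣ k σ × Σ Env λ ρ → Defines A σ ρ B)
    × (Σ (Formula ⊤) λ π → IsΠ k π × Σ Env λ ρ → Defines A π ρ B)

{-# OPTIONS --safe #-}

-- A failure of Σ_{n+1}-induction yields a proper initial segment of M, bounded by d,
-- and an increasing sequence (a_i) cofinal in M indexed by it, whose graph is
-- Δ_{n+1} in (M,A). Bounding every quantifier of a formula P by some a_i with i ≤ j
-- makes comparison of two points a Δ_{n+1} back-and-forth relation H_j. By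
-- collection, if H_j holds between two points for every j, then P transfers between
-- them. Let B be defined by P. Since B is a predicate of the collection scheme, for
-- each i a single j works for all points below a_i at once: H_j-related points there
-- agree on B. Points of equal type are H_j-related, and types are coded by numbers
-- below a bound that does not depend on j. By Σ_{n+1}-separation in (M,A,B) some F
-- codes the triples (i,j,c) such that all points below a_i of type c at stage j lie
-- in B. With F as a parameter, B is Σ_{n+1} in (M,A): x ∈ B iff its type at some such
-- stage is listed in F. The same applies to the complement of B.

module Submission where

open import Defs
open import Data.Nat using (ℕ; zero; suc; z≤n; s≤s) renaming (_+_ to _ℕ+_; _≤_ to _ℕ≤_)
import Data.Nat.Properties as ℕₚ
open import Data.Bool using (Bool; true; false)
open import Data.Empty using (⊥; ⊥-elim)
open import Data.Product using (Σ; _×_; _,_; proj₁; proj₂)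
open import Data.Sum using (_⊎_; inj₁; inj₂)
open import Function using (id; _∘_)
open import Level using (0ℓ)
open import Relation.Nullary using (¬_; yes; no)
open import Relation.Binary.PropositionalEquality
  using (_≡_; refl; sym; trans; cong; cong₂; subst; isEquivalence)
open import Axiom.ExcludedMiddle using (ExcludedMiddle)
open import Algebra.Bundles using (CommutativeSemiring)
open import Algebra.Structures.Biased using (isCommutativeSemiringˡ)
import Algebra.Solver.Ring.NaturalCoefficients.Default as SemiringSolver

private variable
  P Q : Set

-- Simultaneous substitution in terms and formulas

tsub : (ℕ → Term) → Term → Term
tsub σ (var i)  = σ i
tsub σ zeroᵗ    = zeroᵗ
tsub σ oneᵗ     = oneᵗ
tsub σ (t +ᵗ s) = tsub σ t +ᵗ tsub σ s
tsub σ (t *ᵗ s) = tsub σ t *ᵗ tsub σ s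

weaken : Term → Term
weaken = tsub (var ∘ suc)

cons : {X : Set} → X → (ℕ → X) → ℕ → X
cons x f zero    = x
cons x f (suc i) = f i

lift : (ℕ → Term) → ℕ → Term
lift σ = cons (var 0) (weaken ∘ σ)

fsub : (P → Q) → (ℕ → Term) → Formula P → Formula Q
fsub f σ (t ≐ s)   = tsub σ t ≐ tsub σ s
fsub f σ (t <' s)  = tsub σ t <' tsub σ s
fsub f σ (rel p t) = rel (f p) (tsub σ t)
fsub f σ ⊤'        = ⊤'
fsub f σ ⊥'        = ⊥'
fsub f σ (¬' φ)    = ¬' fsub f σ φ
fsub f σ (φ ∧' ψ)  = fsub f σ φ ∧' fsub f σ ψ
fsub f σ (φ ∨' ψ)  = fsub f σ φ ∨' fsub f σ ψ
fsub f σ (φ ⇒' ψ)  = fsub f σ φ ⇒' fsub f σ ψ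
fsub f σ (∀' φ)    = ∀' (fsub f (lift σ) φ)
fsub f σ (∃' φ)    = ∃' (fsub f (lift σ) φ)
fsub f σ (∀<' t φ) = ∀<' (tsub σ t) (fsub f (lift σ) φ)
fsub f σ (∃<' t φ) = ∃<' (tsub σ t) (fsub f (lift σ) φ)

fsub-Δ₀ : (f : P → Q) (σ : ℕ → Term) {φ : Formula P} → IsΔ₀ φ → IsΔ₀ (fsub f σ φ)
fsub-Δ₀ f σ (eq t s)   = eq _ _
fsub-Δ₀ f σ (lt t s)   = lt _ _
fsub-Δ₀ f σ (at p t)   = at _ _
fsub-Δ₀ f σ tru        = tru
fsub-Δ₀ f σ fls        = fls
fsub-Δ₀ f σ (neg d)    = neg (fsub-Δ₀ f σ d)
fsub-Δ₀ f σ (conj d e) = conj (fsub-Δ₀ f σ d) (fsub-Δ₀ f σ e)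
fsub-Δ₀ f σ (disj d e) = disj (fsub-Δ₀ f σ d) (fsub-Δ₀ f σ e)
fsub-Δ₀ f σ (imp d e)  = imp (fsub-Δ₀ f σ d) (fsub-Δ₀ f σ e)
fsub-Δ₀ f σ (ball t d) = ball _ (fsub-Δ₀ f (lift σ) d)
fsub-Δ₀ f σ (bex t d)  = bex _ (fsub-Δ₀ f (lift σ) d)

fsub-Σ : (f : P → Q) (σ : ℕ → Term) {k : ℕ} {φ : Formula P} → IsΣ k φ → IsΣ k (fsub f σ φ)
fsub-Π : (f : P → Q) (σ : ℕ → Term) {k : ℕ} {φ : Formula P} → IsΠ k φ → IsΠ k (fsub f σ φ)
fsub-Σ f σ (Σ-Δ₀ d) = Σ-Δ₀ (fsub-Δ₀ f σ d)
fsub-Σ f σ (Σ-∃Π d) = Σ-∃Π (fsub-Π f (lift σ) d)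
fsub-Σ f σ (Σ-∃Σ d) = Σ-∃Σ (fsub-Σ f (lift σ) d)
fsub-Π f σ (Π-Δ₀ d) = Π-Δ₀ (fsub-Δ₀ f σ d)
fsub-Π f σ (Π-∀Σ d) = Π-∀Σ (fsub-Σ f (lift σ) d)
fsub-Π f σ (Π-∀Π d) = Π-∀Π (fsub-Π f (lift σ) d)

-- (f ⋈ g) lists f 0, g 0, f 1, g 1, …: variables sit at the even positions
-- and parameters at the odd ones.
_⋈_ : {X : Set} → (ℕ → X) → (ℕ → X) → ℕ → X
(f ⋈ g) zero    = f zero
(f ⋈ g) (suc i) = (g ⋈ (f ∘ suc)) i

even odd : ℕ → ℕ
even zero    = zero
even (suc i) = suc (suc (even i))
odd i = suc (even i)

⋈-even : {X : Set} (f g : ℕ → X) (i : ℕ) → (f ⋈ g) (even i) ≡ f i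
⋈-even f g zero    = refl
⋈-even f g (suc i) = ⋈-even (f ∘ suc) (g ∘ suc) i

⋈-odd : {X : Set} (f g : ℕ → X) (i : ℕ) → (f ⋈ g) (odd i) ≡ g i
⋈-odd f g i = ⋈-even g (f ∘ suc) i

module Logic (em : ExcludedMiddle 0ℓ) where

  dne : {X : Set} → ¬ ¬ X → X
  dne {X} h with em {X}
  ... | yes x = x
  ... | no ¬x = ⊥-elim (h ¬x)

  ⊎-of : {X Y : Set} → (¬ X → Y) → X ⊎ Y
  ⊎-of {X} h with em {X}
  ... | yes x = inj₁ x
  ... | no ¬x = inj₂ (h ¬x)

-- Order and division in discretely ordered semirings

module Arithmetic (em : ExcludedMiddle 0ℓ) (𝕄 : Structure) (pm : Semantics.PMinus 𝕄) where
  open Logic em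
  open Structure 𝕄 renaming
    (Carrier to M; _⊕_ to infixl 6 _+_; _⊗_ to infixl 7 _*_; _≺_ to infix 4 _≺_)
  open Semantics 𝕄 using (PMinus)
  open PMinus pm

  infix 4 _≼_

  private
    +-identityˡ : ∀ x → 𝟘 + x ≡ x
    +-identityˡ x = trans (+-comm 𝟘 x) (+-zero x)

    *-identityˡ : ∀ x → 𝟙 * x ≡ x
    *-identityˡ x = trans (*-comm 𝟙 x) (*-one x)

    *-zeroˡ : ∀ x → 𝟘 * x ≡ 𝟘
    *-zeroˡ x = trans (*-comm 𝟘 x) (*-zero x)

    distribʳ : ∀ x y z → (y + z) * x ≡ y * x + z * x
    distribʳ x y z = trans (*-comm _ x) (trans (distrib x y z) (cong₂ _+_ (*-comm x y) (*-comm x z)))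

  semiring : CommutativeSemiring 0ℓ 0ℓ
  semiring = record
    { Carrier = M ; _≈_ = _≡_ ; _+_ = _+_ ; _*_ = _*_ ; 0# = 𝟘 ; 1# = 𝟙
    ; isCommutativeSemiring = isCommutativeSemiringˡ record
      { +-isCommutativeMonoid = record
        { isMonoid = record
          { isSemigroup = record
            { isMagma = record { isEquivalence = isEquivalence ; ∙-cong = cong₂ _+_ }
            ; assoc = +-assoc }
          ; identity = +-identityˡ , +-zero }
        ; comm = +-comm }
      ; *-isCommutativeMonoid = record
        { isMonoid = record
          { isSemigroup = record
            { isMagma = record { isEquivalence = isEquivalence ; ∙-cong = cong₂ _*_ }
            ; assoc = *-assoc }
          ; identity = *-identityˡ , *-one }
        ; comm = *-comm }
      ; distribʳ = distribʳ
      ; zeroˡ = *-zeroˡ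
      }
    }

  module S = SemiringSolver semiring
  open S using (solve; _:=_; _:+_; _:*_; con)

  _≼_ : M → M → Set
  x ≼ y = ¬ (y ≺ x)

  ≺⇒≼ : ∀ {x y} → x ≺ y → x ≼ y
  ≺⇒≼ p q = <-irrefl _ (<-trans _ _ _ p q)

  ≼-refl : ∀ {x} → x ≼ x
  ≼-refl = <-irrefl _

  ≼⇒≺⊎≡ : ∀ {x y} → x ≼ y → x ≺ y ⊎ x ≡ y
  ≼⇒≺⊎≡ {x} {y} h with <-tri x y
  ... | inj₁ p        = inj₁ p
  ... | inj₂ (inj₁ p) = inj₂ p
  ... | inj₂ (inj₂ p) = ⊥-elim (h p)

  ≺-≼-trans : ∀ {x y z} → x ≺ y → y ≼ z → x ≺ z
  ≺-≼-trans p q with ≼⇒≺⊎≡ q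
  ... | inj₁ r    = <-trans _ _ _ p r
  ... | inj₂ refl = p

  ≼-≺-trans : ∀ {x y z} → x ≼ y → y ≺ z → x ≺ z
  ≼-≺-trans p q with ≼⇒≺⊎≡ p
  ... | inj₁ r    = <-trans _ _ _ r q
  ... | inj₂ refl = q

  ≼-trans : ∀ {x y z} → x ≼ y → y ≼ z → x ≼ z
  ≼-trans p q r = p (≼-≺-trans q r)

  ≺𝟘 : ∀ {x} → ¬ (x ≺ 𝟘)
  ≺𝟘 {x} p with nonneg x
  ... | inj₁ q    = ≺⇒≼ p q
  ... | inj₂ refl = <-irrefl _ p

  +-monoˡ-≺ : ∀ {x y} z → x ≺ y → z + x ≺ z + y
  +-monoˡ-≺ {x} {y} z p = subst (_≺ z + y) (+-comm x z) (subst (x + z ≺_) (+-comm y z) (+-mono x y z p))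

  x≼x+y : ∀ x y → x ≼ x + y
  x≼x+y x y p with nonneg y
  ... | inj₁ q    = <-irrefl _ (<-trans _ _ _ p (subst (_≺ x + y) (+-zero x) (+-monoˡ-≺ x q)))
  ... | inj₂ refl = <-irrefl _ (subst (_≺ x) (+-zero x) p)

  y≼x+y : ∀ x y → y ≼ x + y
  y≼x+y x y = subst (y ≼_) (+-comm y x) (x≼x+y y x)

  x≺x+𝟙 : ∀ x → x ≺ x + 𝟙
  x≺x+𝟙 x = subst (_≺ x + 𝟙) (+-zero x) (+-monoˡ-≺ x zero<one)

  ≼⇒≺+𝟙 : ∀ {x y} → x ≼ y → x ≺ y + 𝟙
  ≼⇒≺+𝟙 p = ≼-≺-trans p (x≺x+𝟙 _)

  x≺x+y+𝟙 : ∀ x y → x ≺ (x + y) + 𝟙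
  x≺x+y+𝟙 x y = ≼⇒≺+𝟙 (x≼x+y x y)

  y≺x+y+𝟙 : ∀ x y → y ≺ (x + y) + 𝟙
  y≺x+y+𝟙 x y = ≼⇒≺+𝟙 (y≼x+y x y)

  pred : ∀ x → x ≡ 𝟘 ⊎ Σ M λ z → x ≡ z + 𝟙
  pred x with nonneg x
  ... | inj₂ p = inj₁ (sym p)
  ... | inj₁ p with discrete x p
  ...   | inj₂ q = inj₂ (𝟘 , trans (sym q) (sym (+-identityˡ 𝟙)))
  ...   | inj₁ q with sub 𝟙 x q
  ...     | z , r = inj₂ (z , trans (sym r) (+-comm 𝟙 z))

  ≺⇒gap : ∀ {x y} → x ≺ y → Σ M λ z → y ≡ (x + 𝟙) + z
  ≺⇒gap {x} {y} p with sub x y p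
  ... | z , r with pred z
  ...   | inj₁ refl = ⊥-elim (<-irrefl x (subst (x ≺_) (trans (sym r) (+-zero x)) p))
  ...   | inj₂ (u , refl) = u , trans (sym r) (solve 2 (λ a b → a :+ (b :+ con 1) := (a :+ con 1) :+ b) refl x u)

  ≺+𝟙⇒≼ : ∀ {x y} → x ≺ y + 𝟙 → x ≼ y
  ≺+𝟙⇒≼ {x} {y} p q with ≺⇒gap q
  ... | z , refl = x≼x+y (y + 𝟙) z p

  +𝟙-mono-≺ : ∀ {x y} → x ≺ y → x + 𝟙 ≺ y + 𝟙
  +𝟙-mono-≺ = +-mono _ _ 𝟙

  +𝟙-mono-≼ : ∀ {x y} → x ≼ y → x + 𝟙 ≼ y + 𝟙
  +𝟙-mono-≼ l with ≼⇒≺⊎≡ l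
  ... | inj₁ p    = ≺⇒≼ (+𝟙-mono-≺ p)
  ... | inj₂ refl = ≼-refl

  +-cancelˡ : ∀ z {x y} → z + x ≡ z + y → x ≡ y
  +-cancelˡ z {x} {y} e with <-tri x y
  ... | inj₁ p        = ⊥-elim (<-irrefl _ (subst (_≺ z + y) e (+-monoˡ-≺ z p)))
  ... | inj₂ (inj₁ p) = p
  ... | inj₂ (inj₂ p) = ⊥-elim (<-irrefl _ (subst (z + y ≺_) e (+-monoˡ-≺ z p)))

  private
    quotient≮ : ∀ {p q r q' r'} → r ≺ p → q * p + r ≡ q' * p + r' → ¬ (q ≺ q')
    quotient≮ {p} {q} {r} {q'} {r'} r<p e q<q' with ≺⇒gap q<q'
    ... | z , refl = x≼x+y p (z * p + r') (subst (_≺ p) r≡ r<p)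
      where
      r≡ : r ≡ p + (z * p + r')
      r≡ = +-cancelˡ (q * p) (trans e (solve 4 (λ q z p r' →
             ((q :+ con 1) :+ z) :* p :+ r' := q :* p :+ (p :+ (z :* p :+ r'))) refl q z p r'))

  quotient-unique : ∀ {p q r q' r'} → r ≺ p → r' ≺ p → q * p + r ≡ q' * p + r' → q ≡ q' × r ≡ r'
  quotient-unique {p} {q} {r} {q'} {r'} r<p r'<p e with <-tri q q'
  ... | inj₁ l           = ⊥-elim (quotient≮ r<p e l)
  ... | inj₂ (inj₂ l)    = ⊥-elim (quotient≮ r'<p (sym e) l)
  ... | inj₂ (inj₁ refl) = refl , +-cancelˡ (q * p) e

  -- With `quotient-unique` as its inverse, `i * D + t` pairs i with t ≺ D; this bounds the number
  -- of bits that a set of such pairs takes.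
  pair-bound : ∀ {i t d D} → i ≺ d → t ≺ D → i * D + t ≺ d * D
  pair-bound {i} {t} {d} {D} p q with ≺⇒gap p
  ... | z , refl = subst (i * D + t ≺_)
        (solve 3 (λ i D z → (i :* D :+ D) :+ z :* D := ((i :+ con 1) :+ z) :* D) refl i D z)
        (≺-≼-trans (+-monoˡ-≺ (i * D) q) (x≼x+y _ (z * D)))

-- Definable functions and predicates on environments

module Definability (em : ExcludedMiddle 0ℓ) (𝕄 : Structure) (pm : Semantics.PMinus 𝕄) where
  open Logic em
  open Structure 𝕄 using (𝟘; 𝟙) renaming
    (Carrier to M; _⊕_ to infixl 6 _+_; _⊗_ to infixl 7 _*_; _≺_ to infix 4 _≺_)
  open Semantics 𝕄 renaming (_∷ₑ_ to infixr 5 _∷ₑ_; _↔_ to infix 0 _↔_)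
  open Arithmetic em 𝕄 pm
  open S using (solve; _:=_; _:+_; _:*_; con)
  open PMinus pm

  tail : Env → Env
  tail η i = η (suc i)

  ↔-refl : {X : Set} → X ↔ X
  ↔-refl = id , id

  ↔-sym : {X Y : Set} → X ↔ Y → Y ↔ X
  ↔-sym (f , g) = g , f

  ↔-trans : {X Y Z : Set} → X ↔ Y → Y ↔ Z → X ↔ Z
  ↔-trans (f , g) (f' , g') = f' ∘ f , g ∘ g'

  ≡⇒↔ : {X Y : Set} → X ≡ Y → X ↔ Y
  ≡⇒↔ refl = ↔-refl

  ¬-cong : {X Y : Set} → X ↔ Y → (¬ X) ↔ (¬ Y)
  ¬-cong (f , g) = (λ h y → h (g y)) , λ h x → h (f x)

  ¬∀↔∃¬ : {P : M → Set} → (¬ (∀ m → P m)) ↔ (Σ M λ m → ¬ P m)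
  ¬∀↔∃¬ = (λ h → dne λ ¬e → h λ m → dne λ ¬p → ¬e (m , ¬p)) , λ (m , ¬p) h → ¬p (h m)

  ⟦tsub⟧ : ∀ t {σ : ℕ → Term} {ρ ρ' : Env} → (∀ i → ρ i ≡ ⟦ σ i ⟧ᵗ ρ') → ⟦ t ⟧ᵗ ρ ≡ ⟦ tsub σ t ⟧ᵗ ρ'
  ⟦tsub⟧ (var i)  h = h i
  ⟦tsub⟧ zeroᵗ    h = refl
  ⟦tsub⟧ oneᵗ     h = refl
  ⟦tsub⟧ (t +ᵗ s) h = cong₂ _+_ (⟦tsub⟧ t h) (⟦tsub⟧ s h)
  ⟦tsub⟧ (t *ᵗ s) h = cong₂ _*_ (⟦tsub⟧ t h) (⟦tsub⟧ s h)

  ⟦lift⟧ : ∀ (σ : ℕ → Term) {ρ ρ' : Env} → (∀ i → ρ i ≡ ⟦ σ i ⟧ᵗ ρ') →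
           ∀ m i → (m ∷ₑ ρ) i ≡ ⟦ lift σ i ⟧ᵗ (m ∷ₑ ρ')
  ⟦lift⟧ σ h m zero = refl
  ⟦lift⟧ σ h m (suc i) = trans (h i) (⟦tsub⟧ (σ i) λ _ → refl)

  Sat-fsub : {I : P → M → Set} {J : Q → M → Set} {f : P → Q} → (∀ p x → I p x ↔ J (f p) x) →
             ∀ φ {σ : ℕ → Term} {ρ ρ' : Env} → (∀ i → ρ i ≡ ⟦ σ i ⟧ᵗ ρ') →
             Sat I φ ρ ↔ Sat J (fsub f σ φ) ρ'
  Sat-fsub IJ (t ≐ s) h = ≡⇒↔ (cong₂ _≡_ (⟦tsub⟧ t h) (⟦tsub⟧ s h))
  Sat-fsub IJ (t <' s) h = ≡⇒↔ (cong₂ _≺_ (⟦tsub⟧ t h) (⟦tsub⟧ s h))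
  Sat-fsub {I = I} IJ (rel p t) h = ↔-trans (≡⇒↔ (cong (I p) (⟦tsub⟧ t h))) (IJ p _)
  Sat-fsub IJ ⊤' h = ↔-refl
  Sat-fsub IJ ⊥' h = ↔-refl
  Sat-fsub IJ (¬' φ) h = ¬-cong (Sat-fsub IJ φ h)
  Sat-fsub IJ (φ ∧' ψ) h with Sat-fsub IJ φ h | Sat-fsub IJ ψ h
  ... | a , b | c , d = (λ (x , y) → a x , c y) , (λ (x , y) → b x , d y)
  Sat-fsub IJ (φ ∨' ψ) h with Sat-fsub IJ φ h | Sat-fsub IJ ψ h
  ... | a , b | c , d = (λ { (inj₁ x) → inj₁ (a x) ; (inj₂ y) → inj₂ (c y) })
                      , (λ { (inj₁ x) → inj₁ (b x) ; (inj₂ y) → inj₂ (d y) })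
  Sat-fsub IJ (φ ⇒' ψ) h with Sat-fsub IJ φ h | Sat-fsub IJ ψ h
  ... | a , b | c , d = (λ f x → c (f (b x))) , (λ f x → d (f (a x)))
  Sat-fsub IJ (∀' φ) {σ} h = (λ f m → proj₁ (Sat-fsub IJ φ (⟦lift⟧ σ h m)) (f m))
                       , (λ f m → proj₂ (Sat-fsub IJ φ (⟦lift⟧ σ h m)) (f m))
  Sat-fsub IJ (∃' φ) {σ} h = (λ (m , x) → m , proj₁ (Sat-fsub IJ φ (⟦lift⟧ σ h m)) x)
                       , (λ (m , x) → m , proj₂ (Sat-fsub IJ φ (⟦lift⟧ σ h m)) x)
  Sat-fsub IJ (∀<' t φ) {σ} h =
      (λ f m l → proj₁ (Sat-fsub IJ φ (⟦lift⟧ σ h m)) (f m (subst (m ≺_) (sym (⟦tsub⟧ t h)) l)))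
    , (λ f m l → proj₂ (Sat-fsub IJ φ (⟦lift⟧ σ h m)) (f m (subst (m ≺_) (⟦tsub⟧ t h) l)))
  Sat-fsub IJ (∃<' t φ) {σ} h =
      (λ (m , l , x) → m , subst (m ≺_) (⟦tsub⟧ t h) l , proj₁ (Sat-fsub IJ φ (⟦lift⟧ σ h m)) x)
    , (λ (m , l , x) → m , subst (m ≺_) (sym (⟦tsub⟧ t h)) l , proj₂ (Sat-fsub IJ φ (⟦lift⟧ σ h m)) x)

  ⟦⋈⟧ : {σ τ : ℕ → Term} {f g ζ : Env} → (∀ i → f i ≡ ⟦ σ i ⟧ᵗ ζ) → (∀ i → g i ≡ ⟦ τ i ⟧ᵗ ζ) →
        ∀ i → (f ⋈ g) i ≡ ⟦ (σ ⋈ τ) i ⟧ᵗ ζ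
  ⟦⋈⟧ h k zero    = h zero
  ⟦⋈⟧ h k (suc i) = ⟦⋈⟧ k (h ∘ suc) i

  ⋈-odd-odd : ∀ (η ρ₁ ρ₂ : Env) i → ρ₂ i ≡ (η ⋈ (ρ₁ ⋈ ρ₂)) (odd (odd i))
  ⋈-odd-odd η ρ₁ ρ₂ i = sym (trans (⋈-odd η (ρ₁ ⋈ ρ₂) (odd i)) (⋈-odd ρ₁ ρ₂ i))

  -- Two objects with separate parameter lists are combined over the merged list `ρ₁ ⋈ ρ₂`; these
  -- substitutions recover the environment that each was built for.
  left right : ℕ → Term
  left  = (var ∘ even) ⋈ (var ∘ odd ∘ even)
  right = (var ∘ even) ⋈ (var ∘ odd ∘ odd)

  ⟦left⟧ : ∀ η ρ₁ ρ₂ i → (η ⋈ ρ₁) i ≡ ⟦ left i ⟧ᵗ (η ⋈ (ρ₁ ⋈ ρ₂))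
  ⟦left⟧ η ρ₁ ρ₂ = ⟦⋈⟧ (λ i → sym (⋈-even η _ i))
                       (λ i → sym (trans (⋈-odd η (ρ₁ ⋈ ρ₂) (even i)) (⋈-even ρ₁ ρ₂ i)))

  ⟦right⟧ : ∀ η ρ₁ ρ₂ i → (η ⋈ ρ₂) i ≡ ⟦ right i ⟧ᵗ (η ⋈ (ρ₁ ⋈ ρ₂))
  ⟦right⟧ η ρ₁ ρ₂ = ⟦⋈⟧ (λ i → sym (⋈-even η _ i))
                        (⋈-odd-odd η ρ₁ ρ₂)

  -- Pulls the newly bound variable in front of an interleaved environment.
  under : (ℕ → Term) → ℕ → Term
  under τ = cons (var 0) (weaken ∘ var ∘ even) ⋈ (weaken ∘ τ)

  ⟦under⟧ : ∀ {τ} η ρ ρ' → (∀ i → ρ' i ≡ ⟦ τ i ⟧ᵗ (η ⋈ ρ)) →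
            ∀ m i → ((m ∷ₑ η) ⋈ ρ') i ≡ ⟦ under τ i ⟧ᵗ (m ∷ₑ (η ⋈ ρ))
  ⟦under⟧ {τ} η ρ ρ' h m = ⟦⋈⟧ {σ = cons (var 0) (weaken ∘ var ∘ even)}
    (λ { zero → refl ; (suc i) → sym (⋈-even η ρ i) })
    (λ i → trans (h i) (⟦tsub⟧ (τ i) λ _ → refl))

  -- Indexing by the function lets definability proofs follow its shape. Parameters have positions
  -- of their own, so those of two terms merge without a clash.
  record Tm (f : Env → M) : Set where
    constructor mk
    field
      term   : Term
      params : Env
      eval   : ∀ η → f η ≡ ⟦ term ⟧ᵗ (η ⋈ params)

  record EnvT (L : Env → Env) : Set where
    constructor mk
    field
      terms  : ℕ → Term
      params : Env
      eval   : ∀ η i → L η i ≡ ⟦ terms i ⟧ᵗ (η ⋈ params)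

  v : ∀ i → Tm (λ η → η i)
  v i = mk (var (even i)) (λ _ → 𝟘) λ η → sym (⋈-even η _ i)

  cst : ∀ a → Tm (λ _ → a)
  cst a = mk (var 1) (λ _ → a) λ η → refl

  infixl 6 _⊹_
  infixl 7 _⊛_

  _⊹_ : ∀ {f g} → Tm f → Tm g → Tm (λ η → f η + g η)
  mk t ρ h ⊹ mk s ρ' h' = mk (tsub left t +ᵗ tsub right s) (ρ ⋈ ρ') λ η →
    cong₂ _+_ (trans (h η) (⟦tsub⟧ t (⟦left⟧ η ρ ρ'))) (trans (h' η) (⟦tsub⟧ s (⟦right⟧ η ρ ρ')))

  _⊛_ : ∀ {f g} → Tm f → Tm g → Tm (λ η → f η * g η)
  mk t ρ h ⊛ mk s ρ' h' = mk (tsub left t *ᵗ tsub right s) (ρ ⋈ ρ') λ η →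
    cong₂ _*_ (trans (h η) (⟦tsub⟧ t (⟦left⟧ η ρ ρ'))) (trans (h' η) (⟦tsub⟧ s (⟦right⟧ η ρ ρ')))

  infixr 5 _∷ᵗ_

  _∷ᵗ_ : ∀ {f L} → Tm f → EnvT L → EnvT (λ η → f η ∷ₑ L η)
  mk t ρ h ∷ᵗ mk σ ρ' h' = mk (cons (tsub left t) (tsub right ∘ σ)) (ρ ⋈ ρ') λ
    { η zero    → trans (h η) (⟦tsub⟧ t (⟦left⟧ η ρ ρ'))
    ; η (suc i) → trans (h' η i) (⟦tsub⟧ (σ i) (⟦right⟧ η ρ ρ')) }

  drop : ∀ n → EnvT (λ η i → η (n ℕ+ i))
  drop n = mk (λ i → var (even (n ℕ+ i))) (λ _ → 𝟘) λ η i → sym (⋈-even η _ (n ℕ+ i))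

  cstᵉ : ∀ ρ → EnvT (λ _ → ρ)
  cstᵉ ρ = mk (var ∘ odd) ρ λ η i → sym (⋈-odd η ρ i)

  _∘ᵗ_ : ∀ {f L} → Tm f → EnvT L → Tm (f ∘ L)
  mk t ρ h ∘ᵗ mk σ ρ' h' = mk (tsub ((tsub left ∘ σ) ⋈ (var ∘ odd ∘ odd)) t) (ρ' ⋈ ρ) λ η →
    trans (h _) (⟦tsub⟧ t (⟦⋈⟧ (λ i → trans (h' η i) (⟦tsub⟧ (σ i) (⟦left⟧ η ρ' ρ)))
      (⋈-odd-odd η ρ' ρ)))

  _∘ᵉ_ : ∀ {K L} → EnvT K → EnvT L → EnvT (K ∘ L)
  mk τ ρ h ∘ᵉ mk σ ρ' h' = mk (λ i → tsub ((tsub left ∘ σ) ⋈ (var ∘ odd ∘ odd)) (τ i)) (ρ' ⋈ ρ) λ η j →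
    trans (h _ j) (⟦tsub⟧ (τ j) (⟦⋈⟧ (λ i → trans (h' η i) (⟦tsub⟧ (σ i) (⟦left⟧ η ρ' ρ)))
      (⋈-odd-odd η ρ' ρ)))

  wk : ∀ {f} → Tm f → Tm (λ η → f (tail η))
  wk t = t ∘ᵗ drop 1

  wkᵉ : ∀ {L} → EnvT L → EnvT (λ η → L (tail η))
  wkᵉ L = L ∘ᵉ drop 1

  module Digits (exp : M → M) where

    -- With `exp x` read as the x-th power of two and ε equal to 𝟘 or 𝟙: the binary digit of c at
    -- place x is ε.
    Digit : M → M → M → Set
    Digit ε x c = Σ M λ q → Σ M λ r → r ≺ exp x × c ≡ (q * (𝟙 + 𝟙) + ε) * exp x + r

    Bit : M → M → Set
    Bit = Digit 𝟙

  -- The hierarchy of definable predicates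

  module Class {R : Set} (I : R → M → Set) where

    record D₀ (P : Env → Set) : Set₁ where
      constructor mk
      field
        formula : Formula R
        isΔ₀    : IsΔ₀ formula
        params  : Env
        sat     : ∀ η → P η ↔ Sat I formula (η ⋈ params)

    private
      fsub↔ : ∀ φ {σ ρ ρ'} → (∀ i → ρ i ≡ ⟦ σ i ⟧ᵗ ρ') → Sat I φ ρ ↔ Sat I (fsub id σ φ) ρ'
      fsub↔ = Sat-fsub (λ _ _ → ↔-refl)

    D₀-resp : ∀ {P Q} → (∀ η → P η ↔ Q η) → D₀ P → D₀ Q
    D₀-resp h (mk φ d ρ s) = mk φ d ρ λ η → ↔-trans (↔-sym (h η)) (s η)

    D₀-sub : ∀ {P L} → D₀ P → EnvT L → D₀ (λ η → P (L η))
    D₀-sub (mk φ d ρ h) (mk σ ρ' h') =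
      mk (fsub id ((tsub left ∘ σ) ⋈ (var ∘ odd ∘ odd)) φ) (fsub-Δ₀ id _ d) (ρ' ⋈ ρ) λ η →
      ↔-trans (h _) (fsub↔ φ (⟦⋈⟧ (λ i → trans (h' η i) (⟦tsub⟧ (σ i) (⟦left⟧ η ρ' ρ)))
      (⋈-odd-odd η ρ' ρ)))

    D₀-≡ : ∀ {f g} → Tm f → Tm g → D₀ (λ η → f η ≡ g η)
    D₀-≡ (mk t ρ h) (mk s ρ' h') = mk (tsub left t ≐ tsub right s) (eq _ _) (ρ ⋈ ρ') λ η →
      ≡⇒↔ (cong₂ _≡_ (trans (h η) (⟦tsub⟧ t (⟦left⟧ η ρ ρ'))) (trans (h' η) (⟦tsub⟧ s (⟦right⟧ η ρ ρ'))))

    D₀-≺ : ∀ {f g} → Tm f → Tm g → D₀ (λ η → f η ≺ g η)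
    D₀-≺ (mk t ρ h) (mk s ρ' h') = mk (tsub left t <' tsub right s) (lt _ _) (ρ ⋈ ρ') λ η →
      ≡⇒↔ (cong₂ _≺_ (trans (h η) (⟦tsub⟧ t (⟦left⟧ η ρ ρ'))) (trans (h' η) (⟦tsub⟧ s (⟦right⟧ η ρ ρ'))))

    D₀-rel : ∀ p {f} → Tm f → D₀ (λ η → I p (f η))
    D₀-rel p (mk t ρ h) = mk (rel p t) (at _ _) ρ λ η → ≡⇒↔ (cong (I p) (h η))

    D₀-¬ : ∀ {P} → D₀ P → D₀ (λ η → ¬ P η)
    D₀-¬ (mk φ d ρ h) = mk (¬' φ) (neg d) ρ λ η → ¬-cong (h η)

    D₀-× : ∀ {P Q} → D₀ P → D₀ Q → D₀ (λ η → P η × Q η)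
    D₀-× (mk φ d ρ h) (mk ψ e ρ' h') =
      mk (fsub id left φ ∧' fsub id right ψ) (conj (fsub-Δ₀ id _ d) (fsub-Δ₀ id _ e)) (ρ ⋈ ρ') λ η →
      let (a , b) = ↔-trans (h η) (fsub↔ φ (⟦left⟧ η ρ ρ'))
          (a' , b') = ↔-trans (h' η) (fsub↔ ψ (⟦right⟧ η ρ ρ'))
      in (λ (x , y) → a x , a' y) , (λ (x , y) → b x , b' y)

    D₀-∀≺ : ∀ {f} {P : M → Env → Set} → Tm f → D₀ (λ η → P (η 0) (tail η)) →
            D₀ (λ η → ∀ m → m ≺ f η → P m η)
    D₀-∀≺ (mk t ρ h) (mk φ d ρ' h') =
      mk (∀<' (tsub left t) (fsub id (under (var ∘ odd ∘ odd)) φ)) (ball _ (fsub-Δ₀ id _ d)) (ρ ⋈ ρ') λ η →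
      let e = trans (h η) (⟦tsub⟧ t (⟦left⟧ η ρ ρ'))
          s = λ m → ↔-trans (h' (m ∷ₑ η)) (fsub↔ φ (⟦under⟧ η (ρ ⋈ ρ') ρ'
                (⋈-odd-odd η ρ ρ') m))
      in (λ p m l → proj₁ (s m) (p m (subst (m ≺_) (sym e) l)))
       , (λ p m l → proj₂ (s m) (p m (subst (m ≺_) e l)))

    -- Π predicates occur only as negations, and level k means exactly k quantifiers before a Δ₀
    -- matrix. Recursion on a derivation, as for the back-and-forth relation, then has just two
    -- cases.
    data SΣ : ℕ → (Env → Set) → Set₁ where
      base : ∀ {P} → D₀ P → SΣ zero P
      step : ∀ {k P} (Q : M → Env → Set) → SΣ k (λ η → Q (η 0) (tail η)) →
             (∀ η → P η ↔ Σ M λ m → ¬ Q m η) → SΣ (suc k) P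

    resp : ∀ {k P Q} → (∀ η → P η ↔ Q η) → SΣ k P → SΣ k Q
    resp h (base d) = base (D₀-resp h d)
    resp h (step Q q s) = step Q q λ η → ↔-trans (↔-sym (h η)) (s η)

    _[_] : ∀ {k P L} → SΣ k P → EnvT L → SΣ k (λ η → P (L η))
    base d [ L ] = base (D₀-sub d L)
    _[_] {L = L} (step Q q s) l = step (λ m η → Q m (L η)) (q [ v 0 ∷ᵗ wkᵉ l ]) λ η → s (L η)

    D₀⇒SΣ : ∀ {k P} → D₀ P → SΣ k P
    D₀⇒SΣ {zero} d = base d
    D₀⇒SΣ {suc k} {P} d = step (λ _ η → ¬ P η) (D₀⇒SΣ (D₀-sub (D₀-¬ d) (drop 1)))
      λ η → (λ p → 𝟘 , λ ¬p → ¬p p) , λ (_ , p) → dne p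

    ¬-up : ∀ {k P} → SΣ k P → SΣ (suc k) (λ η → ¬ P η)
    ¬-up {P = P} s = step (λ _ → P) (s [ drop 1 ]) λ η → (𝟘 ,_) , proj₂

    -- The vacuous quantifier is inserted innermost, next to the Δ₀ matrix, so the outer witnesses
    -- stay the same.
    up : ∀ {k P} → SΣ k P → SΣ (suc k) P
    up (base d) = D₀⇒SΣ d
    up (step Q q s) = step Q (up q) s

    up≤ : ∀ {k l P} → k ℕ≤ l → SΣ k P → SΣ l P
    up≤ z≤n (base d) = D₀⇒SΣ d
    up≤ (s≤s h) (step Q q s) = step Q (up≤ h q) s

    realizeΣ : ∀ {k P} → SΣ k P → Σ (Formula R) λ φ → IsΣ k φ × Σ Env λ ρ → ∀ η → P η ↔ Sat I φ (η ⋈ ρ)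
    realizeΠ : ∀ {k P} → SΣ k P → Σ (Formula R) λ φ → IsΠ k φ × Σ Env λ ρ → ∀ η → (¬ P η) ↔ Sat I φ (η ⋈ ρ)
    realizeΣ (base (mk φ d ρ h)) = φ , Σ-Δ₀ d , ρ , h
    realizeΣ (step Q q s) with realizeΠ q
    ... | φ , π , ρ , h = ∃' (fsub id (under (var ∘ odd)) φ) , Σ-∃Π (fsub-Π id _ π) , ρ , λ η →
      let t = λ m → ↔-trans (h (m ∷ₑ η)) (fsub↔ φ (⟦under⟧ η ρ ρ (λ i → sym (⋈-odd η ρ i)) m))
      in ↔-trans (s η) ((λ (m , x) → m , proj₁ (t m) x) , (λ (m , x) → m , proj₂ (t m) x))
    realizeΠ (base (mk φ d ρ h)) = ¬' φ , Π-Δ₀ (neg d) , ρ , λ η → ¬-cong (h η)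
    realizeΠ (step Q q s) with realizeΣ q
    ... | φ , π , ρ , h = ∀' (fsub id (under (var ∘ odd)) φ) , Π-∀Σ (fsub-Σ id _ π) , ρ , λ η →
      let t = λ m → ↔-trans (h (m ∷ₑ η)) (fsub↔ φ (⟦under⟧ η ρ ρ (λ i → sym (⋈-odd η ρ i)) m))
      in (λ x m → proj₁ (t m) (dne λ ¬q → x (proj₂ (s η) (m , ¬q))))
       , (λ f x → let (m , ¬q) = proj₁ (s η) x in ¬q (proj₂ (t m) (f m)))

    D₀-pure : {φ : Formula ⊥} → IsΔ₀ φ → D₀ (λ η → Sat noPred φ η)
    D₀-pure {φ} d = mk (fsub ⊥-elim (var ∘ even) φ) (fsub-Δ₀ _ _ d) (λ _ → 𝟘) λ η →
      Sat-fsub (λ ()) φ (λ i → sym (⋈-even η _ i))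

    D₀-Sat : {φ : Formula R} → IsΔ₀ φ → D₀ (λ η → Sat I φ η)
    D₀-Sat {φ} d = mk (fsub id (var ∘ even) φ) (fsub-Δ₀ _ _ d) (λ _ → 𝟘) λ η →
      fsub↔ φ (λ i → sym (⋈-even η _ i))

    -- The level is left open because the given definition of B may lie beyond the level for which
    -- collection holds.
    Arithmetical : (Env → Set) → Set₁
    Arithmetical P = Σ ℕ λ k → SΣ k P

    ar-D₀ : ∀ {P} → D₀ P → Arithmetical P
    ar-D₀ d = zero , base d

    ar-resp : ∀ {P Q} → (∀ η → P η ↔ Q η) → Arithmetical P → Arithmetical Q
    ar-resp h (k , s) = k , resp h s

    ar-sub : ∀ {P L} → Arithmetical P → EnvT L → Arithmetical (λ η → P (L η))
    ar-sub (k , s) L = k , s [ L ]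

    ar-¬ : ∀ {P} → Arithmetical P → Arithmetical (λ η → ¬ P η)
    ar-¬ (k , s) = suc k , ¬-up s

    ar-∃ : {P : M → Env → Set} → Arithmetical (λ η → P (η 0) (tail η)) → Arithmetical (λ η → Σ M λ m → P m η)
    ar-∃ {P} (k , s) = suc (suc k) , step (λ m η → ¬ P m η) (¬-up s)
      λ η → (λ (m , p) → m , λ ¬p → ¬p p) , λ (m , ¬¬p) → m , dne ¬¬p

    ar-∀ : {P : M → Env → Set} → Arithmetical (λ η → P (η 0) (tail η)) → Arithmetical (λ η → ∀ m → P m η)
    ar-∀ a = ar-resp (λ η → (λ h m → dne λ ¬p → h (m , ¬p)) , λ h (m , ¬p) → ¬p (h m)) (ar-¬ (ar-∃ (ar-¬ a)))

    -- Collection is available only up to level N, so a conjunction of formulas of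
    -- arbitrary level is brought to prenex form one quantifier at a time.
    private
      D₀-×-ar : ∀ {k P Q} → D₀ P → SΣ k Q → Arithmetical (λ η → P η × Q η)
      D₀-×-¬ar : ∀ {k P Q} → D₀ P → SΣ k Q → Arithmetical (λ η → P η × ¬ Q η)
      D₀-×-ar d (base e) = ar-D₀ (D₀-× d e)
      D₀-×-ar {P = P} d (step Q q s) = ar-resp
        (λ η → (λ (m , p , ¬q) → p , proj₂ (s η) (m , ¬q))
             , λ (p , x) → let (m , ¬q) = proj₁ (s η) x in m , p , ¬q)
        (ar-∃ {λ m η → P η × ¬ Q m η} (D₀-×-¬ar (D₀-sub d (drop 1)) q))
      D₀-×-¬ar d (base e) = ar-D₀ (D₀-× d (D₀-¬ e))
      D₀-×-¬ar {P = P} d (step Q q s) = ar-resp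
        -- The conjunct `P η` does not mention m, so any instance returns it; 𝟘 is an arbitrary
        -- choice.
        (λ η → (λ h → proj₁ (h 𝟘) , λ x → let (m , ¬q) = proj₁ (s η) x in ¬q (proj₂ (h m)))
             , λ (p , ¬x) m → p , dne λ ¬q → ¬x (proj₂ (s η) (m , ¬q)))
        (ar-∀ {λ m η → P η × Q m η} (D₀-×-ar (D₀-sub d (drop 1)) q))

      SΣ-×-ar : ∀ {k P Q} → SΣ k P → Arithmetical Q → Arithmetical (λ η → P η × Q η)
      ¬SΣ-×-ar : ∀ {k P Q} → SΣ k P → Arithmetical Q → Arithmetical (λ η → (¬ P η) × Q η)
      SΣ-×-ar (base d) (_ , t) = D₀-×-ar d t
      SΣ-×-ar {Q = Q} (step P p s) a = ar-resp
        (λ η → (λ (m , ¬p , y) → proj₂ (s η) (m , ¬p) , y)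
             , λ (x , y) → let (m , ¬p) = proj₁ (s η) x in m , ¬p , y)
        (ar-∃ {λ m η → (¬ P m η) × Q η} (¬SΣ-×-ar p (ar-sub a (drop 1))))
      ¬SΣ-×-ar (base d) (_ , t) = D₀-×-ar (D₀-¬ d) t
      ¬SΣ-×-ar {Q = Q} (step P p s) a = ar-resp
        (λ η → (λ h → (λ x → let (m , ¬p) = proj₁ (s η) x in ¬p (proj₁ (h m))) , proj₂ (h 𝟘))
             , λ (¬x , y) m → (dne λ ¬p → ¬x (proj₂ (s η) (m , ¬p))) , y)
        (ar-∀ {λ m η → P m η × Q η} (SΣ-×-ar p (ar-sub a (drop 1))))

    ar-× : ∀ {P Q} → Arithmetical P → Arithmetical Q → Arithmetical (λ η → P η × Q η)
    ar-× (_ , s) a = SΣ-×-ar s a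

    ar-→ : ∀ {P Q} → Arithmetical P → Arithmetical Q → Arithmetical (λ η → P η → Q η)
    ar-→ p q = ar-resp (λ η → (λ h x → dne λ ¬y → h (x , ¬y)) , λ h (x , ¬y) → ¬y (h x))
      (ar-¬ (ar-× p (ar-¬ q)))

    ⟦_⟧-Tm : ∀ t → Tm ⟦ t ⟧ᵗ
    ⟦ t ⟧-Tm = mk (tsub (var ∘ even) t) (λ _ → 𝟘) λ η → ⟦tsub⟧ t (λ i → sym (⋈-even η _ i))

    ar-Sat : ∀ φ → Arithmetical (Sat I φ)
    ar-Sat (t ≐ s)   = ar-D₀ (D₀-Sat (eq t s))
    ar-Sat (t <' s)  = ar-D₀ (D₀-Sat (lt t s))
    ar-Sat (rel p t) = ar-D₀ (D₀-Sat (at p t))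
    ar-Sat ⊤'        = ar-D₀ (D₀-Sat tru)
    ar-Sat ⊥'        = ar-D₀ (D₀-Sat fls)
    ar-Sat (¬' φ)    = ar-¬ (ar-Sat φ)
    ar-Sat (φ ∧' ψ)  = ar-× (ar-Sat φ) (ar-Sat ψ)
    ar-Sat (φ ∨' ψ)  = ar-resp (λ η → ⊎-of , λ { (inj₁ x) ¬x → ⊥-elim (¬x x) ; (inj₂ y) _ → y })
                         (ar-→ (ar-¬ (ar-Sat φ)) (ar-Sat ψ))
    ar-Sat (φ ⇒' ψ)  = ar-→ (ar-Sat φ) (ar-Sat ψ)
    ar-Sat (∀' φ)    = ar-∀ (ar-sub (ar-Sat φ) (v 0 ∷ᵗ drop 1))
    ar-Sat (∃' φ)    = ar-∃ (ar-sub (ar-Sat φ) (v 0 ∷ᵗ drop 1))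
    ar-Sat (∀<' t φ) = ar-∀ (ar-→ (ar-D₀ (D₀-≺ (v 0) (wk ⟦ t ⟧-Tm))) (ar-sub (ar-Sat φ) (v 0 ∷ᵗ drop 1)))
    ar-Sat (∃<' t φ) = ar-∃ (ar-× (ar-D₀ (D₀-≺ (v 0) (wk ⟦ t ⟧-Tm))) (ar-sub (ar-Sat φ) (v 0 ∷ᵗ drop 1)))

    -- Closure properties obtained from collection

    module Bounding (n : ℕ) (bs : BΣ-scheme (suc n) I) where

      N : ℕ
      N = suc n

      collect : (V : M → M → Set) → SΣ N (λ η → V (η 0) (η 1)) →
                ∀ a → (∀ x → x ≺ a → Σ M λ y → V y x) →
                Σ M λ b → ∀ x → x ≺ a → Σ M λ y → y ≺ b × V y x
      collect V s a f with realizeΣ s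
      ... | φ , φΣ , ρ , h =
        -- In `y ∷ₑ x ∷ₑ ρ` the parameters come after two variables. The same ρ also pads the
        -- variable part.
        let τ = var ⋈ (var ∘ suc ∘ suc)
            e = λ y x → ↔-trans (h (y ∷ₑ x ∷ₑ ρ)) (fsub↔ φ (⟦⋈⟧ (λ _ → refl) (λ _ → refl)))
            (b , g) = bs (fsub id τ φ) (fsub-Σ id τ φΣ) ρ a
                        λ x l → let (y , p) = f x l in y , proj₁ (e y x) p
        in b , λ x l → let (y , m , p) = g x l in y , m , proj₂ (e y x) p

      record Closed (k : ℕ) : Set₁ where
        field
          ⊎-cl : ∀ {P Q} → SΣ k P → SΣ k Q → SΣ k (λ η → P η ⊎ Q η)
          ×-cl : ∀ {P Q} → SΣ k P → SΣ k Q → SΣ k (λ η → P η × Q η)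
          ∀≺-cl : ∀ {f} {P : M → Env → Set} → Tm f → SΣ k (λ η → P (η 0) (tail η)) →
                  SΣ k (λ η → ∀ m → m ≺ f η → P m η)
          ∃≺-cl : ∀ {f} {P : M → Env → Set} → Tm f → SΣ k (λ η → P (η 0) (tail η)) →
                  SΣ k (λ η → Σ M λ m → m ≺ f η × P m η)

      -- Induction on k: the matrix of a predicate at level `suc k` has level k and enters negated,
      -- so each operation reduces to operations one level down.
      closed : ∀ k → k ℕ≤ N → Closed k
      closed zero _ = record
        { ⊎-cl = λ { (base d) (base e) → base (D₀-resp
            (λ η → (λ h → ⊎-of λ ¬p → dne λ ¬q → h (¬p , ¬q))
                 , λ { (inj₁ p) (¬p , _) → ¬p p ; (inj₂ q) (_ , ¬q) → ¬q q })
            (D₀-¬ (D₀-× (D₀-¬ d) (D₀-¬ e)))) }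
        ; ×-cl = λ { (base d) (base e) → base (D₀-× d e) }
        ; ∀≺-cl = λ { t (base d) → base (D₀-∀≺ t d) }
        ; ∃≺-cl = λ { t (base d) → base (D₀-resp
            (λ η → (λ h → dne λ ¬e → h λ m l p → ¬e (m , l , p))
                 , λ (m , l , p) h → h m l p)
            (D₀-¬ (D₀-∀≺ t (D₀-¬ d)))) }
        }
      closed (suc k) le = record
        { ⊎-cl = λ { (step P p r) (step Q q s) →
            step (λ m η → P m η × Q m η) (×-cl p q) λ η →
              (λ { (inj₁ x) → let (m , ¬p) = proj₁ (r η) x in m , λ (p , _) → ¬p p
                 ; (inj₂ y) → let (m , ¬q) = proj₁ (s η) y in m , λ (_ , q) → ¬q q })
              , λ (m , h) → ⊎-of λ ¬x → proj₂ (s η) (m , λ q →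
                  ¬x (proj₂ (r η) (m , λ p → h (p , q)))) }
        ; ×-cl = λ { (step P p r) (step Q q s) →
            -- The new witness w is a common strict bound for the two old ones.
            step (λ w η → ∀ m → m ≺ w → ∀ m' → m' ≺ w → P m η ⊎ Q m' η)
              (∀≺-cl (v 0) (∀≺-cl (v 1) (⊎-cl (p [ v 1 ∷ᵗ drop 3 ]) (q [ v 0 ∷ᵗ drop 3 ])))) λ η →
              (λ (x , y) →
                let (m , ¬p) = proj₁ (r η) x ; (m' , ¬q) = proj₁ (s η) y in
                (m + m') + 𝟙 , λ h → case⊎ (h m (x≺x+y+𝟙 m m') m' (y≺x+y+𝟙 m m')) ¬p ¬q)
              , λ (w , h) →
                 (proj₂ (r η) (dne λ ¬e → h λ m l m' l' → inj₁ (dne λ ¬p → ¬e (m , ¬p))))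
               , (proj₂ (s η) (dne λ ¬e → h λ m l m' l' → inj₂ (dne λ ¬q → ¬e (m' , ¬q)))) }
        ; ∀≺-cl = ∀≺'
        ; ∃≺-cl = λ { {f} {P} t (step Q q s) →
            step (λ w η → ∀ x → x ≺ f η → ∀ m → m ≺ w → Q m (x ∷ₑ η))
              (∀≺-cl (wk t) (∀≺-cl (v 1) (q [ v 0 ∷ᵗ v 1 ∷ᵗ drop 3 ]))) λ η →
              (λ (x , l , p) → let (m , ¬q) = proj₁ (s (x ∷ₑ η)) p in
                 m + 𝟙 , λ h → ¬q (h x l m (x≺x+𝟙 m)))
              , λ (w , h) → dne λ ¬e → h λ x l m l' → dne λ ¬q →
                  ¬e (x , l , proj₂ (s (x ∷ₑ η)) (m , ¬q)) }
        }
        where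
        open Closed (closed k (ℕₚ.≤-trans (ℕₚ.n≤1+n k) le))

        case⊎ : {X Y Z : Set} → X ⊎ Y → (X → Z) → (Y → Z) → Z
        case⊎ (inj₁ x) f g = f x
        case⊎ (inj₂ y) f g = g y

        ∀≺' : ∀ {f} {P : M → Env → Set} → Tm f → SΣ (suc k) (λ η → P (η 0) (tail η)) →
              SΣ (suc k) (λ η → ∀ m → m ≺ f η → P m η)
        ∀≺' {f} {P} t (step Q q s) =
          step (λ b η → Σ M λ x → x ≺ f η × (∀ m → m ≺ b → Q m (x ∷ₑ η)))
            (∃≺-cl (wk t) (∀≺-cl (v 1) (q [ v 0 ∷ᵗ v 1 ∷ᵗ drop 3 ]))) λ η →
            (λ h →
              -- Collection gives the witnesses for all x below `f η` one bound b, and b becomes the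
              -- single outer witness.
              let (b , g) = collect (λ m x → ¬ Q m (x ∷ₑ η))
                    (up≤ le (¬-up (q [ v 0 ∷ᵗ v 1 ∷ᵗ cstᵉ η ]))) (f η)
                    λ x l → proj₁ (s (x ∷ₑ η)) (h x l)
              in b , λ (x , l , h') → let (m , l' , ¬q) = g x l in ¬q (h' m l'))
            , λ (b , h) x l → proj₂ (s (x ∷ₑ η)) (dne λ ¬e →
                h (x , l , λ m l' → dne λ ¬q → ¬e (m , ¬q)))

      ∃-cl : ∀ {k} {P : M → Env → Set} → suc k ℕ≤ N → SΣ (suc k) (λ η → P (η 0) (tail η)) →
             SΣ (suc k) (λ η → Σ M λ m → P m η)
      ∃-cl {k} le (step Q q s) =
        step (λ w η → ∀ m → m ≺ w → ∀ m' → m' ≺ w → Q m' (m ∷ₑ η))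
          (∀≺-cl (v 0) (∀≺-cl (v 1) (q [ v 0 ∷ᵗ v 1 ∷ᵗ drop 3 ]))) λ η →
          (λ (m , p) → let (m' , ¬q) = proj₁ (s (m ∷ₑ η)) p in
             (m + m') + 𝟙 , λ h → ¬q (h m (x≺x+y+𝟙 m m') m' (y≺x+y+𝟙 m m')))
          , λ (w , h) → dne λ ¬e → h λ m l m' l' → dne λ ¬q → ¬e (m , proj₂ (s (m ∷ₑ η)) (m' , ¬q))
        where open Closed (closed k (ℕₚ.≤-trans (ℕₚ.n≤1+n k) le))

      open Closed (closed N ℕₚ.≤-refl) public

      ∃-clN : {P : M → Env → Set} → SΣ N (λ η → P (η 0) (tail η)) → SΣ N (λ η → Σ M λ m → P m η)
      ∃-clN = ∃-cl ℕₚ.≤-refl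

      record Δ (P : Env → Set) : Set₁ where
        constructor mk
        field
          Δ⇒Σ : SΣ N P
          Δ⇒Π : SΣ N (λ η → ¬ P η)

      open Δ public

      ¬¬-↔ : {X : Set} → X ↔ (¬ ¬ X)
      ¬¬-↔ = (λ x ¬x → ¬x x) , dne

      Δ-SΣ : ∀ {k P} → suc k ℕ≤ N → SΣ k P → Δ P
      Δ-SΣ le s = mk (up≤ le (up s)) (up≤ le (¬-up s))

      Δ-D₀ : ∀ {P} → D₀ P → Δ P
      Δ-D₀ d = mk (D₀⇒SΣ d) (D₀⇒SΣ (D₀-¬ d))

      Δ-resp : ∀ {P Q} → (∀ η → P η ↔ Q η) → Δ P → Δ Q
      Δ-resp h (mk p q) = mk (resp h p) (resp (λ η → ¬-cong (h η)) q)

      Δ-sub : ∀ {P L} → Δ P → EnvT L → Δ (λ η → P (L η))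
      Δ-sub (mk p q) L = mk (p [ L ]) (q [ L ])

      Δ-≡ : ∀ {f g} → Tm f → Tm g → Δ (λ η → f η ≡ g η)
      Δ-≡ t s = Δ-D₀ (D₀-≡ t s)

      Δ-≺ : ∀ {f g} → Tm f → Tm g → Δ (λ η → f η ≺ g η)
      Δ-≺ t s = Δ-D₀ (D₀-≺ t s)

      Δ-¬ : ∀ {P} → Δ P → Δ (λ η → ¬ P η)
      Δ-¬ (mk p q) = mk q (resp (λ _ → ¬¬-↔) p)

      Δ-× : ∀ {P Q} → Δ P → Δ Q → Δ (λ η → P η × Q η)
      Δ-× (mk p p') (mk q q') = mk (×-cl p q) (resp (λ η →
        (λ { (inj₁ ¬p) (p , _) → ¬p p ; (inj₂ ¬q) (_ , q) → ¬q q })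
        , λ h → ⊎-of λ ¬¬p q → ¬¬p λ p → h (p , q)) (⊎-cl p' q'))

      Δ-→ : ∀ {P Q} → Δ P → Δ Q → Δ (λ η → P η → Q η)
      Δ-→ p q = Δ-resp (λ η → (λ h x → dne λ ¬y → h (x , ¬y)) , λ h (x , ¬y) → ¬y (h x))
        (Δ-¬ (Δ-× p (Δ-¬ q)))

      Δ-↔ : ∀ {P Q} → Δ P → Δ Q → Δ (λ η → P η ↔ Q η)
      Δ-↔ p q = Δ-× (Δ-→ p q) (Δ-→ q p)

      Δ-∀≺ : ∀ {f} {P : M → Env → Set} → Tm f → Δ (λ η → P (η 0) (tail η)) →
             Δ (λ η → ∀ m → m ≺ f η → P m η)
      Δ-∀≺ t (mk p q) = mk (∀≺-cl t p) (resp (λ η →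
        (λ (m , l , ¬p) h → ¬p (h m l))
        , λ h → dne λ ¬e → h λ m l → dne λ ¬p → ¬e (m , l , ¬p)) (∃≺-cl t q))

      Δ-∃≺ : ∀ {f} {P : M → Env → Set} → Tm f → Δ (λ η → P (η 0) (tail η)) →
             Δ (λ η → Σ M λ m → m ≺ f η × P m η)
      Δ-∃≺ t p = Δ-resp (λ η → (λ h → dne λ ¬e → h λ m l x → ¬e (m , l , x))
        , λ (m , l , x) h → h m l x) (Δ-¬ (Δ-∀≺ t (Δ-¬ p)))

      Δ₁ : (M → Set) → Set₁
      Δ₁ V = Δ (λ η → V (η 0))

      Δ₂ : (M → M → Set) → Set₁
      Δ₂ V = Δ (λ η → V (η 0) (η 1))

      -- `IsΣ` and `IsΠ` admit blocks of like quantifiers; `∃-cl` contracts each block to the one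
      -- quantifier that `SΣ` has per level.
      ofΣ : ∀ {k φ} → k ℕ≤ N → IsΣ k φ → SΣ k (Sat I φ)
      ofΠ : ∀ {k φ} → k ℕ≤ N → IsΠ k φ → SΣ k (λ η → ¬ Sat I φ η)
      ofΣ le (Σ-Δ₀ d) = D₀⇒SΣ (D₀-Sat d)
      ofΣ le (Σ-∃Π {φ = φ} π) = step (λ m η → ¬ Sat I φ (m ∷ₑ η))
        (ofΠ (ℕₚ.≤-trans (ℕₚ.n≤1+n _) le) π [ v 0 ∷ᵗ drop 1 ])
        λ η → (λ (m , p) → m , λ ¬p → ¬p p) , λ (m , ¬¬p) → m , dne ¬¬p
      ofΣ le (Σ-∃Σ σ) = ∃-cl le (ofΣ le σ [ v 0 ∷ᵗ drop 1 ])
      ofΠ le (Π-Δ₀ d) = D₀⇒SΣ (D₀-¬ (D₀-Sat d))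
      ofΠ le (Π-∀Σ {φ = φ} σ) = step (λ m η → Sat I φ (m ∷ₑ η))
        (ofΣ (ℕₚ.≤-trans (ℕₚ.n≤1+n _) le) σ [ v 0 ∷ᵗ drop 1 ]) λ η → ¬∀↔∃¬
      ofΠ le (Π-∀Π {φ = φ} π) = resp (λ η → ↔-sym ¬∀↔∃¬) (∃-cl le (ofΠ le π [ v 0 ∷ᵗ drop 1 ]))

      -- Abstract in `exp`, so that bits are available both in the language with A and B, where the
      -- facts on `exp` are proved, and in the language with A alone.
      module Digital (exp : M → M) (exp-def : D₀ (λ η → η 0 ≡ exp (η 1)))
                     (¬bit : ∀ x c → (¬ Digits.Bit exp x c) ↔ Digits.Digit exp 𝟘 x c) where
        open Digits exp

        private
          exp-cl : ∀ {f} {P : M → Env → Set} → Tm f → SΣ N (λ η → P (η 0) (tail η)) → SΣ N (λ η → P (exp (f η)) η)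
          exp-cl {f} {P} t s = resp (λ η → (λ { (_ , refl , p) → p }) , λ p → _ , refl , p)
            (∃-clN {λ y η → y ≡ exp (f η) × P y η} (×-cl (D₀⇒SΣ (D₀-sub exp-def (v 0 ∷ᵗ wk t ∷ᵗ drop 0))) s))

        -- As `exp` is a total function with Δ₀ graph, the property of its value and the negation
        -- are both existential over the graph.
        Δ-exp : ∀ {f} {P : M → Env → Set} → Tm f → Δ (λ η → P (η 0) (tail η)) → Δ (λ η → P (exp (f η)) η)
        Δ-exp {f} {P} t (mk p q) = mk (exp-cl {P = P} t p) (exp-cl {P = λ m η → ¬ P m η} t q)

        private
          Digit-Σ : ∀ ε → SΣ N (λ η → Digit ε (η 0) (η 1))
          Digit-Σ ε = ∃-clN (∃-clN (exp-cl
            {P = λ p η → η 0 ≺ p × η 3 ≡ (η 1 * (𝟙 + 𝟙) + ε) * p + η 0} (v 2)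
            (×-cl (D₀⇒SΣ (D₀-≺ (v 1) (v 0)))
              (D₀⇒SΣ (D₀-≡ (v 4) ((v 2 ⊛ cst (𝟙 + 𝟙) ⊹ cst ε) ⊛ v 0 ⊹ v 1))))))

        -- A digit other than 1 is 0, and that is again an existential statement.
        Δ-Bit : Δ₂ Bit
        Δ-Bit = mk (Digit-Σ 𝟙) (resp (λ η → ↔-sym (¬bit (η 0) (η 1))) (Digit-Σ 𝟘))

      -- Induction derived from collection

      module Induction (ind₀ : Δ₀-Ind I) where

        Inductive : (M → Set) → Set
        Inductive V = V 𝟘 → (∀ x → V x → V (x + 𝟙)) → ∀ x → V x

        -- Bounding the witness w of ¬ Q w x by b, the failure of V at a − x becomes
        -- a Σ_k property of x.
        induction-step : ∀ {k} → suc k ℕ≤ N → (∀ V → SΣ k (λ η → V (η 0)) → Inductive V) →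
          ∀ V → SΣ (suc k) (λ η → V (η 0)) → SΣ N (λ η → ¬ V (η 0)) → Inductive V
        induction-step {k} le ind V (step Q q s) ¬V V0 VS a = dne λ ¬Va →
          let (b , Vb) = bound
              -- Descent started at a cannot last `a + 𝟙` steps: it would need z with z + (a + 𝟙) =
              -- a.
              (z , _ , e , _) = ind (Fails b) (Fails-def b)
                (a , x≺x+𝟙 a , +-zero a , λ w _ → dne λ ¬q → ¬Va (proj₂ (s' a) (w , ¬q)))
                (Fails-step b Vb) (a + 𝟙)
          in subst (a + 𝟙 ≼_) e (y≼x+y z (a + 𝟙)) (x≺x+𝟙 a)
          where
          module Cₖ = Closed (closed k (ℕₚ.≤-trans (ℕₚ.n≤1+n k) le))
          ε : Env
          ε _ = 𝟘
          s' : ∀ x → V x ↔ Σ M λ w → ¬ Q w (x ∷ₑ ε)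
          s' x = s (x ∷ₑ ε)
          -- Each x either has a witness for V or falls outside V, where 𝟘 serves as a dummy
          -- witness. Both alternatives are Σ of level N, so collection applies.
          bound : Σ M λ b → ∀ x → x ≺ a + 𝟙 → Σ M λ w → w ≺ b × (¬ Q w (x ∷ₑ ε) ⊎ ¬ V x)
          bound = collect (λ w x → ¬ Q w (x ∷ₑ ε) ⊎ ¬ V x)
            (⊎-cl (up≤ le (¬-up (q [ v 0 ∷ᵗ v 1 ∷ᵗ cstᵉ ε ]))) (¬V [ v 1 ∷ᵗ drop 0 ])) (a + 𝟙)
            λ x _ → dne λ ¬e → ¬e (𝟘 , inj₂ λ Vx → let (w , ¬q) = proj₁ (s' x) Vx in ¬e (w , inj₁ ¬q))
          Fails : M → M → Set
          Fails b x = Σ M λ z → z ≺ a + 𝟙 × (z + x ≡ a × (∀ w → w ≺ b → Q w (z ∷ₑ ε)))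
          Fails-def : ∀ b → SΣ k (λ η → Fails b (η 0))
          Fails-def b = Cₖ.∃≺-cl (cst (a + 𝟙)) (Cₖ.×-cl (D₀⇒SΣ (D₀-≡ (v 0 ⊹ v 1) (cst a)))
                      (Cₖ.∀≺-cl (cst b) (q [ v 0 ∷ᵗ v 1 ∷ᵗ cstᵉ ε ])))
          Fails-step : ∀ b → (∀ x → x ≺ a + 𝟙 → Σ M λ w → w ≺ b × (¬ Q w (x ∷ₑ ε) ⊎ ¬ V x)) →
                   ∀ x → Fails b x → Fails b (x + 𝟙)
          Fails-step b Vb x (z , l , e , h) with pred z
          ... | inj₁ refl with Vb 𝟘 l
          ...   | w , l' , inj₁ ¬q = ⊥-elim (¬q (h w l'))
          ...   | w , l' , inj₂ ¬V0 = ⊥-elim (¬V0 V0)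
          Fails-step b Vb x (z , l , e , h) | inj₂ (z' , refl) =
            z' , <-trans _ _ _ (x≺x+𝟙 z') l , trans (solve 2 (λ z x → z :+ (x :+ con 1) := (z :+ con 1) :+ x) refl z' x) e
            , λ w _ → dne λ ¬q → contra (VS z' (proj₂ (s' z') (w , ¬q)))
            where
            contra : V (z' + 𝟙) → ⊥
            contra Vz with Vb (z' + 𝟙) l
            ... | w , l' , inj₁ ¬q = ¬q (h w l')
            ... | w , l' , inj₂ ¬V' = ¬V' Vz

        Σ-induction : ∀ k → suc k ℕ≤ N → ∀ V → SΣ k (λ η → V (η 0)) → Inductive V
        Σ-induction zero _ V (base (mk φ d ρ h)) V0 VS x =
          proj₂ (e x) (ind₀ (fsub id τ φ) (fsub-Δ₀ id τ d) ρ (proj₁ (e 𝟘) V0)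
            (λ y p → proj₁ (e (y + 𝟙)) (VS y (proj₂ (e y) p))) x)
          where
          τ = var ⋈ (var ∘ suc)
          e = λ x → ↔-trans (h (x ∷ₑ ρ)) (fsub↔ φ (⟦⋈⟧ (λ _ → refl) (λ _ → refl)))
        Σ-induction (suc k) le V s =
          induction-step (ℕₚ.≤-trans (ℕₚ.n≤1+n _) le) (Σ-induction k (ℕₚ.≤-trans (ℕₚ.n≤1+n _) le)) V s
            (up≤ le (¬-up s))

        -- At level N the complement is Σ by hypothesis, and `induction-step` then asks only for
        -- induction at level n.
        Δ-induction : ∀ V → Δ₁ V → Inductive V
        Δ-induction V (mk s t) = induction-step ℕₚ.≤-refl (Σ-induction n ℕₚ.≤-refl) V s t

  -- Exponentiation and binary codes of sets

  module Coding {R : Set} (I : R → M → Set) (n : ℕ) (ind₀ : Δ₀-Ind I) (bs : BΣ-scheme (suc n) I)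
                (exponential : Exp) where
    open Class I
    open Bounding n bs
    open Induction ind₀

    D₀-induction : ∀ V → D₀ (λ η → V (η 0)) → Inductive V
    D₀-induction V d = Σ-induction 0 (s≤s z≤n) V (base d)

    exp : M → M
    exp x = let (_ , _ , _ , _ , _ , total) = exponential in proj₁ (total x)

    private
      Graph : M → M → Set
      Graph y x = let (E , _ , ρ , _) = exponential in Sat noPred E (y ∷ₑ x ∷ₑ ρ)

      Graph-exp : ∀ x → Graph (exp x) x
      Graph-exp x = let (_ , _ , _ , _ , _ , total) = exponential in proj₂ (total x)

      Graph-𝟘 : ∀ y → Graph y 𝟘 ↔ (y ≡ 𝟙)
      Graph-𝟘 = let (_ , _ , _ , h , _) = exponential in h

      Graph-suc : ∀ x z → Graph z (x + 𝟙) ↔ (Σ M λ y → Graph y x × (z ≡ y + y))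
      Graph-suc = let (_ , _ , _ , _ , h , _) = exponential in h

      Graph-def : {Q : Set} (J : Q → M → Set) → Class.D₀ J (λ η → Graph (η 0) (η 1))
      Graph-def J = let (_ , d , ρ , _) = exponential in
        Class.D₀-sub J (Class.D₀-pure J d) (v 0 ∷ᵗ v 1 ∷ᵗ cstᵉ ρ)

      -- `Exp` states totality; uniqueness is by induction on x. With both values below a fixed b
      -- the formula is Δ₀, and the values at x are no larger than those at `x + 𝟙`.
      Graph-unique : ∀ x y y' → Graph y x → Graph y' x → y ≡ y'
      Graph-unique x y y' g g' = dne λ ≢ →
        D₀-induction V (D₀-∀≺ (cst b) (D₀-∀≺ (cst b) (D₀-¬ (D₀-× (D₀-sub (Graph-def I) (v 1 ∷ᵗ v 2 ∷ᵗ drop 0))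
            (D₀-× (D₀-sub (Graph-def I) (v 0 ∷ᵗ v 2 ∷ᵗ drop 0)) (D₀-¬ (D₀-≡ (v 1) (v 0))))))))
          (λ y _ y' _ (p , p' , ≢) → ≢ (trans (proj₁ (Graph-𝟘 y) p) (sym (proj₁ (Graph-𝟘 y') p'))))
          V-suc x y (x≺x+y+𝟙 y y') y' (y≺x+y+𝟙 y y') (g , g' , ≢)
        where
        b = (y + y') + 𝟙
        V : M → Set
        V x = ∀ y → y ≺ b → ∀ y' → y' ≺ b → ¬ (Graph y x × Graph y' x × ¬ y ≡ y')
        V-suc : ∀ x → V x → V (x + 𝟙)
        V-suc x ih z l z' l' (p , p' , ≢) with proj₁ (Graph-suc x z) p | proj₁ (Graph-suc x z') p'
        ... | y , q , refl | y' , q' , refl =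
          ih y (≼-≺-trans (x≼x+y y y) l) y' (≼-≺-trans (x≼x+y y' y') l') (q , q' , ≢ ∘ cong λ y → y + y)

    exp-def : {Q : Set} (J : Q → M → Set) → Class.D₀ J (λ η → η 0 ≡ exp (η 1))
    exp-def J = Class.D₀-resp J (λ η →
      (λ g → Graph-unique _ _ _ g (Graph-exp _)) , λ e → subst (λ y → Graph y (η 1)) (sym e) (Graph-exp _))
      (Graph-def J)

    exp-𝟘 : exp 𝟘 ≡ 𝟙
    exp-𝟘 = proj₁ (Graph-𝟘 _) (Graph-exp 𝟘)

    exp-suc : ∀ x → exp (x + 𝟙) ≡ exp x + exp x
    exp-suc x = Graph-unique (x + 𝟙) _ _ (Graph-exp _) (proj₂ (Graph-suc x _) (exp x , Graph-exp x , refl))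

    𝟘≺exp : ∀ x → 𝟘 ≺ exp x
    𝟘≺exp x with nonneg (exp x)
    ... | inj₁ l = l
    ... | inj₂ e = ⊥-elim (D₀-induction (λ x → ¬ 𝟘 ≡ exp x) (D₀-¬ (D₀-sub (exp-def I) (cst 𝟘 ∷ᵗ drop 0)))
      (λ e → <-irrefl 𝟘 (subst (𝟘 ≺_) (sym (trans e exp-𝟘)) zero<one))
      suc-case x e)
      where
      suc-case : ∀ x → ¬ 𝟘 ≡ exp x → ¬ 𝟘 ≡ exp (x + 𝟙)
      suc-case x ≢ e with nonneg (exp x)
      ... | inj₁ l = subst (exp x ≼_) (sym (trans e (exp-suc x))) (x≼x+y _ _) l
      ... | inj₂ e' = ≢ e'

    division : ∀ p → 𝟘 ≺ p → ∀ c → Σ M λ q → Σ M λ r → r ≺ p × c ≡ q * p + r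
    -- The quotient is at most c, which keeps the induction formula Δ₀.
    division p 0<p c = dne λ ¬e → D₀-induction V
      (D₀-¬ (D₀-∀≺ (v 0 ⊹ cst 𝟙) (D₀-∀≺ (cst p) (D₀-¬ (D₀-≡ (v 2) (v 1 ⊛ cst p ⊹ v 0))))))
      (λ h → h 𝟘 (≼⇒≺+𝟙 ≼-refl) 𝟘 0<p (solve 1 (λ p → con 0 := con 0 :* p :+ con 0) refl p))
      V-suc c λ q _ r l e → ¬e (q , r , l , e)
      where
      V : M → Set
      V c = ¬ (∀ q → q ≺ c + 𝟙 → ∀ r → r ≺ p → ¬ c ≡ q * p + r)
      V-suc : ∀ c → V c → V (c + 𝟙)
      V-suc c ih h = ih λ q lq r lr e → step-case q lq r lr e (<-tri (r + 𝟙) p)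
        where
        step-case : ∀ q → q ≺ c + 𝟙 → ∀ r → r ≺ p → c ≡ q * p + r → (r + 𝟙 ≺ p) ⊎ (r + 𝟙 ≡ p) ⊎ (p ≺ r + 𝟙) → ⊥
        step-case q lq r lr e (inj₁ l) = h q (<-trans _ _ _ lq (x≺x+𝟙 _)) (r + 𝟙) l
          (trans (cong (_+ 𝟙) e) (+-assoc _ _ _))
        step-case q lq r lr e (inj₂ (inj₁ refl)) = h (q + 𝟙) (+𝟙-mono-≺ lq) 𝟘 0<p
          (trans (cong (_+ 𝟙) e) (solve 2 (λ q r → (q :* (r :+ con 1) :+ r) :+ con 1 := (q :+ con 1) :* (r :+ con 1) :+ con 0) refl q r))
        step-case q lq r lr e (inj₂ (inj₂ l)) = ≺+𝟙⇒≼ l lr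

    open Digits exp public

    private
      𝟙≺𝟚 : 𝟙 ≺ 𝟙 + 𝟙
      𝟙≺𝟚 = x≺x+𝟙 𝟙

      𝟘≺𝟚 : 𝟘 ≺ 𝟙 + 𝟙
      𝟘≺𝟚 = <-trans _ _ _ zero<one 𝟙≺𝟚

    -- Dividing c by `exp x` and the quotient by two leaves 0 or 1 as digit; uniqueness of division
    -- excludes having both.
    ¬Bit : ∀ x c → (¬ Bit x c) ↔ Digit 𝟘 x c
    ¬Bit x c = to , from
      where
      to : ¬ Bit x c → Digit 𝟘 x c
      to ¬b with division (exp x) (𝟘≺exp x) c
      ... | q , r , l , refl with division (𝟙 + 𝟙) 𝟘≺𝟚 q
      ...   | q' , ε , l' , refl with pred ε
      ...     | inj₁ refl = q' , r , l , refl
      ...     | inj₂ (ε' , refl) with pred ε'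
      ...       | inj₁ refl = ⊥-elim (¬b (q' , r , l , cong (λ z → (q' * (𝟙 + 𝟙) + z) * exp x + r) (trans (+-comm 𝟘 𝟙) (+-zero 𝟙))))
      ...       | inj₂ (ε″ , refl) = ⊥-elim (≺+𝟙⇒≼ l' (≼⇒≺+𝟙 (y≼x+y ε″ 𝟙)))
      from : Digit 𝟘 x c → ¬ Bit x c
      from (q , r , l , e) (q' , r' , l' , e') = <-irrefl 𝟘 (subst (𝟘 ≺_)
        (proj₂ (quotient-unique 𝟙≺𝟚 𝟘≺𝟚 (proj₁ (quotient-unique l' l (trans (sym e') e))))) zero<one)

    open Digital exp (exp-def I) ¬Bit

    exp-+ : ∀ x y → exp (x + y) ≡ exp x * exp y
    exp-+ x = Δ-induction (λ y → exp (x + y) ≡ exp x * exp y)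
      (Δ-exp {f = λ η → x + η 0} {P = λ m η → m ≡ exp x * exp (η 0)} (cst x ⊹ v 0)
        (Δ-exp {P = λ m η → η 0 ≡ exp x * m} (v 1) (Δ-≡ (v 1) (cst (exp x) ⊛ v 0))))
      (trans (cong exp (+-zero x)) (sym (trans (cong (exp x *_) exp-𝟘) (*-one _))))
      λ y ih → trans (cong exp (sym (+-assoc x y 𝟙))) (trans (exp-suc (x + y))
        (trans (cong₂ _+_ ih ih) (trans (sym (distrib _ _ _)) (cong (exp x *_) (sym (exp-suc y))))))

    private
      -- For x ≺ z the number `exp z` is an even multiple of `exp x`, so adding it changes only the
      -- part of c above digit x.
      Digit-+exp : ∀ {ε x z c} → x ≺ z → Digit ε x c → Digit ε x (c + exp z)
      Digit-+exp {ε} {x} l (q , r , l' , refl) with ≺⇒gap l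
      ... | y , refl = q + exp y , r , l' , trans (cong ((q * (𝟙 + 𝟙) + ε) * exp x + r +_) (trans (exp-+ (x + 𝟙) y) (cong (_* exp y) (exp-suc x))))
        (solve 5 (λ q ε p r e → ((q :* (con 1 :+ con 1) :+ ε) :* p :+ r) :+ (p :+ p) :* e
                             := ((q :+ e) :* (con 1 :+ con 1) :+ ε) :* p :+ r) refl q ε (exp x) r (exp y))

    -- Induction on z. The bound `exp z` on the code makes its existence a Δ statement.
    comprehension : ∀ {V} → Δ₁ V → ∀ z → Σ M λ c → c ≺ exp z × (∀ x → x ≺ z → Bit x c ↔ V x)
    comprehension {V} s = Δ-induction Coded
      (Δ-exp {P = λ m η → Σ M λ c → c ≺ m × (∀ x → x ≺ η 0 → Bit x c ↔ V x)} (v 0)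
        (Δ-∃≺ {P = λ c η → ∀ x → x ≺ η 1 → Bit x c ↔ V x} (v 0)
          (Δ-∀≺ {P = λ x η → Bit x (η 0) ↔ V x} (v 2) (Δ-↔ (Δ-sub Δ-Bit (v 0 ∷ᵗ v 1 ∷ᵗ drop 0)) (Δ-sub s (v 0 ∷ᵗ drop 0))))))
      (𝟘 , 𝟘≺exp 𝟘 , λ x l → ⊥-elim (≺𝟘 l))
      Coded-suc
      where
      Coded : M → Set
      Coded z = Σ M λ c → c ≺ exp z × (∀ x → x ≺ z → Bit x c ↔ V x)
      Coded-suc : ∀ z → Coded z → Coded (z + 𝟙)
      Coded-suc z (c , l , h) with em {V z}
      -- Since c is below `exp z`, its bit z is 0; the sum sets it and keeps the lower bits.
      ... | yes Vz = c + exp z , subst (c + exp z ≺_) (sym (exp-suc z)) (+-mono c (exp z) (exp z) l) , h'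
        where
        h' : ∀ x → x ≺ z + 𝟙 → Bit x (c + exp z) ↔ V x
        h' x l' with ≼⇒≺⊎≡ (≺+𝟙⇒≼ l')
        ... | inj₁ l = (λ b → proj₁ (h x l) (dne λ ¬b → proj₂ (¬Bit x _) (Digit-+exp l (proj₁ (¬Bit x c) ¬b)) b))
                     , λ Vx → Digit-+exp l (proj₂ (h x l) Vx)
        ... | inj₂ refl = (λ _ → Vz)
          , λ _ → 𝟘 , c , l , solve 2 (λ c p → c :+ p := (con 0 :* (con 1 :+ con 1) :+ con 1) :* p :+ c) refl c (exp z)
      ... | no ¬Vz = c , subst (c ≺_) (sym (exp-suc z)) (≺-≼-trans l (x≼x+y _ _)) , h'
        where
        h' : ∀ x → x ≺ z + 𝟙 → Bit x c ↔ V x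
        h' x l' with ≼⇒≺⊎≡ (≺+𝟙⇒≼ l')
        ... | inj₁ l = h x l
        ... | inj₂ refl = (λ b → ⊥-elim (proj₂ (¬Bit z c) (𝟘 , c , l
                , solve 2 (λ c p → c := (con 0 :* (con 1 :+ con 1) :+ con 0) :* p :+ c) refl c (exp z)) b))
          , λ Vz → ⊥-elim (¬Vz Vz)

    -- If no code below exp z separates, the witnesses of their failures are bounded;
    -- the part of X enumerated below the bound then has a code that separates.
    separation : ∀ {X Y : M → Set} → SΣ N (λ η → X (η 0)) → SΣ N (λ η → Y (η 0)) → (∀ x → X x → ¬ Y x) →
                 ∀ z → Σ M λ F → ∀ x → x ≺ z → (X x → Bit x F) × (Y x → ¬ Bit x F)
    separation {X} {Y} (step Q q s) (step T t u) disjoint z = dne λ ¬sep → contra ¬sep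
      where
      ε : Env
      ε _ = 𝟘
      Err : M → M → M → Set
      Err m x F = (¬ Q m (x ∷ₑ ε) × ¬ Bit x F) ⊎ (¬ T m (x ∷ₑ ε) × Bit x F)
      Err-def : SΣ N (λ η → Err (η 0) (η 1) (η 2))
      Err-def = ⊎-cl (×-cl (¬-up (q [ v 0 ∷ᵗ v 1 ∷ᵗ cstᵉ ε ])) (Δ⇒Π Δ-Bit [ v 1 ∷ᵗ drop 2 ]))
                     (×-cl (¬-up (t [ v 0 ∷ᵗ v 1 ∷ᵗ cstᵉ ε ])) (Δ⇒Σ Δ-Bit [ v 1 ∷ᵗ drop 2 ]))
      Separates : M → M → Set
      Separates F x = (X x → Bit x F) × (Y x → ¬ Bit x F)
      errs : (¬ Σ M λ F → ∀ x → x ≺ z → Separates F x) →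
             ∀ F → F ≺ exp z → Σ M λ w → Σ M λ x → x ≺ z × (Σ M λ m → m ≺ w × Err m x F)
      errs ¬sep F _ = dne λ ¬e → ¬sep (F , λ x l →
          (λ Xx → dne λ ¬b → let (m , ¬q) = proj₁ (s (x ∷ₑ ε)) Xx in
            ¬e (m + 𝟙 , x , l , m , x≺x+𝟙 m , inj₁ (¬q , ¬b)))
        , (λ Yx b → let (m , ¬t) = proj₁ (u (x ∷ₑ ε)) Yx in
            ¬e (m + 𝟙 , x , l , m , x≺x+𝟙 m , inj₂ (¬t , b))))
      contra : (¬ Σ M λ F → ∀ x → x ≺ z → Separates F x) → ⊥
      contra ¬sep =
        let (b , h) = collect (λ w F → Σ M λ x → x ≺ z × (Σ M λ m → m ≺ w × Err m x F))
              (∃≺-cl {P = λ x η → Σ M λ m → m ≺ η 0 × Err m x (η 1)} (cst z)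
                (∃≺-cl {P = λ m η → Err m (η 0) (η 2)} (v 1) (Err-def [ v 0 ∷ᵗ v 1 ∷ᵗ drop 3 ]))) (exp z) (errs ¬sep)
            (F , l , bit) = comprehension {λ x → Σ M λ m → m ≺ b × ¬ Q m (x ∷ₑ ε)}
              (Δ-∃≺ (cst b) (Δ-¬ (Δ-SΣ ℕₚ.≤-refl (q [ v 0 ∷ᵗ v 1 ∷ᵗ cstᵉ ε ])))) z
            (w , l' , x , lx , m , lm , err) = h F l
        in no-err b F bit w l' x lx m lm err
        where
        no-err : ∀ b F → (∀ x → x ≺ z → Bit x F ↔ (Σ M λ m → m ≺ b × ¬ Q m (x ∷ₑ ε))) →
                 ∀ w → w ≺ b → ∀ x → x ≺ z → ∀ m → m ≺ w → ¬ Err m x F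
        no-err b F bit w l' x lx m lm (inj₁ (¬q , ¬b)) = ¬b (proj₂ (bit x lx) (m , <-trans _ _ _ lm l' , ¬q))
        -- An error of the second kind would put x into both X and Y.
        no-err b F bit w l' x lx m lm (inj₂ (¬t , y)) =
          let (m' , _ , ¬q) = proj₁ (bit x lx) y
          in disjoint x (proj₂ (s (x ∷ₑ ε)) (m' , ¬q)) (proj₂ (u (x ∷ₑ ε)) (m , ¬t))

  -- Expansion of the language

  module Transfer {R R' : Set} (I : R → M → Set) (J : R' → M → Set) (f : R → R')
                  (IJ : ∀ p x → I p x ↔ J (f p) x) where
    private
      module 𝐈 = Class I
      module 𝐉 = Class J

    Sat-map : ∀ φ ρ → Sat I φ ρ ↔ Sat J (fsub f var φ) ρ
    Sat-map φ ρ = Sat-fsub IJ φ λ _ → refl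

    D₀-map : ∀ {P} → 𝐈.D₀ P → 𝐉.D₀ P
    D₀-map (𝐈.mk φ d ρ h) = 𝐉.mk (fsub f var φ) (fsub-Δ₀ f var d) ρ λ η → ↔-trans (h η) (Sat-map φ _)

    SΣ-map : ∀ {k P} → 𝐈.SΣ k P → 𝐉.SΣ k P
    SΣ-map (𝐈.base d) = 𝐉.base (D₀-map d)
    SΣ-map (𝐈.step Q q s) = 𝐉.step Q (SΣ-map q) s

    BΣ-pull : ∀ k → BΣ-scheme k J → BΣ-scheme k I
    BΣ-pull k bs φ σ ρ a h =
      let (b , g) = bs (fsub f var φ) (fsub-Σ f var σ) ρ a λ x l → let (y , p) = h x l in y , proj₁ (Sat-map φ _) p
      in b , λ x l → let (y , l' , p) = g x l in y , l' , proj₂ (Sat-map φ _) p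

    Δ-map : ∀ n bs bs' {P} → 𝐈.Bounding.Δ n bs P → 𝐉.Bounding.Δ n bs' P
    Δ-map n bs bs' (𝐈.Bounding.mk s t) = 𝐉.Bounding.mk (SΣ-map s) (SΣ-map t)

  -- The cut, its cofinal sequence and back-and-forth relations

  module Interpretation {R R' : Set} (I : R → M → Set) (J : R' → M → Set) (f : R → R')
    (IJ : ∀ p x → I p x ↔ J (f p) x) (n : ℕ)
    (ind₀ : Δ₀-Ind J) (bs : BΣ-scheme (suc n) J) (exponential : Exp)
    (Q : M → M → Set) (Q-def : Class.SΣ I n (λ η → Q (η 0) (η 1))) (d : M)
    (V-zero : Σ M λ w → ¬ Q w 𝟘)
    (V-suc : ∀ x → (Σ M λ w → ¬ Q w x) → Σ M λ w → ¬ Q w (x + 𝟙))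
    (V-fails : ¬ Σ M λ w → ¬ Q w d) where

    open Transfer I J f IJ
    -- Definitions are kept over `I`, so that the final one mentions A only; induction and coding
    -- take place over `J`, to which `⇑` lifts them.
    module 𝐈 where
      open Class I public
      open Bounding n (BΣ-pull (suc n) bs) public
    module 𝐉 where
      open Class J public
      open Bounding n bs public
      open Induction ind₀ public
      open Coding J n ind₀ bs exponential public
    open 𝐈 using (SΣ; Δ; Δ-≺; Δ-≡; Δ-¬; Δ-×; Δ-↔; Δ-→; Δ-∀≺; Δ-∃≺; Δ-sub; Δ-D₀)
    open 𝐉 using (exp; Bit)
    open 𝐈.Digital exp (𝐉.exp-def I) 𝐉.¬Bit using (Δ-Bit)

    ⇑ : ∀ {P} → Δ P → 𝐉.Δ P
    ⇑ = Δ-map n (BΣ-pull (suc n) bs) bs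

    -- K w i says that a_i ≤ w, where a_i is the least bound for witnesses of the
    -- first i + 1 instances; x < a_i is expressed as ¬ K x i.
    K : M → M → Set
    K w i = ∀ y → y ≺ i + 𝟙 → Σ M λ m → m ≺ w × ¬ Q m y

    K-def : ∀ {g h} → Tm g → Tm h → Δ (λ η → K (g η) (h η))
    K-def g h = Δ-∀≺ (h ⊹ cst 𝟙) (Δ-∃≺ (wk g) (Δ-¬ (Δ-sub (𝐈.Δ-SΣ ℕₚ.≤-refl Q-def) (v 0 ∷ᵗ v 1 ∷ᵗ drop 0))))

    K-mono : ∀ {w w' i} → w ≼ w' → K w i → K w' i
    K-mono l k y ly = let (m , lm , q) = k y ly in m , ≺-≼-trans lm l , q

    K-anti : ∀ {w i j} → i ≼ j → K w j → K w i
    K-anti l k y ly = k y (≺-≼-trans ly (+𝟙-mono-≼ l))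

    K-bounded : ∀ {w i} → K w i → i ≺ d
    K-bounded {w} {i} k = dne λ h → let (m , _ , q) = k d (≼⇒≺+𝟙 h) in V-fails (m , q)

    ¬K⇒≺ : ∀ {r w i} → K w i → ¬ K r i → r ≺ w
    ¬K⇒≺ k h = dne λ l → h (K-mono l k)

    -- Otherwise b bounds every a_i. Then `K b` is a Δ property and inherits closure under successor
    -- from V, so induction carries it up to d, which has no witness.
    K-cofinal : ∀ b → Σ M λ i → Σ M λ w → K w i × ¬ K b i
    K-cofinal b = dne λ none →
      let below : ∀ i w → K w i → K b i
          below i w k = dne λ h → none (i , w , k , h)
          K-zero = let (m , q) = V-zero in below 𝟘 (m + 𝟙) λ y l → m , x≺x+𝟙 m , subst (λ y → ¬ Q m y) (sym (zero-only l)) q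
          all : ∀ i → K b i
          all = 𝐉.Δ-induction (K b) (⇑ (K-def (cst b) (v 0))) K-zero (K-step below)
          (m , _ , q) = all d d (x≺x+𝟙 d)
      in V-fails (m , q)
      where
      zero-only : ∀ {y} → y ≺ 𝟘 + 𝟙 → y ≡ 𝟘
      zero-only l with ≼⇒≺⊎≡ (≺+𝟙⇒≼ l)
      ... | inj₁ p = ⊥-elim (≺𝟘 p)
      ... | inj₂ e = e
      K-step : (∀ i w → K w i → K b i) → ∀ i → K b i → K b (i + 𝟙)
      K-step below i k = let (m₀ , _ , q₀) = k i (x≺x+𝟙 i) ; (m , q) = V-suc i (m₀ , q₀) in
        -- This bound exceeds the old witnesses, which lie below b, and the new witness m; `below`
        -- then lowers it to b.
        below (i + 𝟙) ((b + m) + 𝟙) (λ y l → extend y m q (≼⇒≺⊎≡ (≺+𝟙⇒≼ l)))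
        where
        extend : ∀ y m → ¬ Q m (i + 𝟙) → y ≺ i + 𝟙 ⊎ y ≡ i + 𝟙 → Σ M λ m' → m' ≺ (b + m) + 𝟙 × ¬ Q m' y
        extend y m q (inj₁ l) = let (m' , l' , q') = k y l in m' , <-trans _ _ _ l' (x≺x+y+𝟙 b m) , q'
        extend y m q (inj₂ refl) = m , y≺x+y+𝟙 b m , q

    K-directed : ∀ {w i w' i'} → K w i → K w' i' → Σ M λ u → Σ M λ j → K u j × i ≼ j × i' ≼ j
    K-directed {w} {i} {w'} {i'} k k' with <-tri i i'
    ... | inj₁ l           = w' , i' , k' , ≺⇒≼ l , ≼-refl
    ... | inj₂ (inj₁ refl) = w , i , k , ≼-refl , ≼-refl
    ... | inj₂ (inj₂ l)    = w , i , k , ≼-refl , ≺⇒≼ l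

    -- Collection bounds the pairs (w , j) that defeat the x below a; a single later
    -- pair defeats all of them.
    compactness : (U : M → M → M → Set) → 𝐉.Δ (λ η → U (η 0) (η 1) (η 2)) →
      (∀ {w j w' j' x} → K w j → K w' j' → j ≼ j' → U w' j' x → U w j x) →
      ∀ a {w₀ i₀} → K w₀ i₀ → (∀ x → x ≺ a → Σ M λ w → Σ M λ j → K w j × ¬ U w j x) →
      Σ M λ w → Σ M λ j → K w j × i₀ ≼ j × (∀ x → x ≺ a → ¬ U w j x)
    compactness U U-def U-mono a k₀ h =
      let (b , g) = 𝐉.collect V (𝐉.∃≺-cl {P = λ w η → Σ M λ j → j ≺ η 0 × (K w j × ¬ U w j (η 1))} (v 0)
             (𝐉.∃≺-cl {P = λ j η → K (η 0) j × ¬ U (η 0) j (η 2)} (v 1)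
               (𝐉.Δ⇒Σ (𝐉.Δ-× (⇑ (K-def (v 1) (v 0))) (𝐉.Δ-¬ (𝐉.Δ-sub U-def (v 1 ∷ᵗ v 0 ∷ᵗ v 3 ∷ᵗ drop 0)))))))
             a λ x l → let (w , j , k , ¬u) = h x l in
               (w + j) + 𝟙 , w , x≺x+y+𝟙 w j , j , y≺x+y+𝟙 w j , k , ¬u
          -- Here a_i exceeds b. A collected pair has w₁ ≺ b, so its index j₁ is at most i.
          (i , w , k , ¬k) = K-cofinal b
          (w' , j' , k' , i≼j' , i₀≼j') = K-directed k k₀
      in w' , j' , k' , i₀≼j' , λ x l u →
        let (y , y≺b , w₁ , w₁≺y , j₁ , _ , k₁ , ¬u) = g x l
        in ¬u (U-mono k₁ k' (≼-trans (λ p → ¬k (K-mono (≺⇒≼ (<-trans _ _ _ w₁≺y y≺b)) (K-anti (≺⇒≼ p) k₁))) i≼j') u)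
      where
      V : M → M → Set
      V y x = Σ M λ w → w ≺ y × (Σ M λ j → j ≺ y × (K w j × ¬ U w j x))

    -- An Ehrenfeucht–Fraïssé relation one way: it transfers P from ρ to ρ′, moves
    -- being bounded by some a_i with i ≤ j.
    H : ∀ {k P} → SΣ k P → M → M → Env → Env → Set
    H (𝐈.base {P} _)   w j ρ ρ' = P ρ → P ρ'
    H (𝐈.step _ q _) w j ρ ρ' = ∀ i → i ≺ j + 𝟙 → ∀ r → r ≺ w → ¬ K r i →
      Σ M λ s → s ≺ w × (¬ K s i × H q w j (s ∷ₑ ρ') (r ∷ₑ ρ))

    H-def : ∀ {k P} (p : SΣ k P) {g h L L'} → Tm g → Tm h → EnvT L → EnvT L' →
            Δ (λ η → H p (g η) (h η) (L η) (L' η))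
    H-def (𝐈.base D) g h l l' = Δ-→ (Δ-D₀ (𝐈.D₀-sub D l)) (Δ-D₀ (𝐈.D₀-sub D l'))
    H-def (𝐈.step _ q _) {g'} {h'} {L} {L'} g h l l' =
      Δ-∀≺ {P = λ i η → ∀ r → r ≺ g' η → ¬ K r i → Σ M λ s → s ≺ g' η × (¬ K s i × H q (g' η) (h' η) (s ∷ₑ L' η) (r ∷ₑ L η))}
        (h ⊹ cst 𝟙)
      (Δ-∀≺ {P = λ r η → ¬ K r (η 0) → Σ M λ s → s ≺ g' (tail η) × (¬ K s (η 0) × H q (g' (tail η)) (h' (tail η)) (s ∷ₑ L' (tail η)) (r ∷ₑ L (tail η)))}
        (wk g) (Δ-→ (Δ-¬ (K-def (v 0) (v 1)))
      (Δ-∃≺ {P = λ s η → ¬ K s (η 1) × H q (g' (tail (tail η))) (h' (tail (tail η))) (s ∷ₑ L' (tail (tail η))) (η 0 ∷ₑ L (tail (tail η)))}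
        (wk (wk g)) (Δ-× (Δ-¬ (K-def (v 0) (v 2)))
          (H-def q (wk (wk (wk g))) (wk (wk (wk h))) (v 0 ∷ᵗ wkᵉ (wkᵉ (wkᵉ l'))) (v 1 ∷ᵗ wkᵉ (wkᵉ (wkᵉ l))))))))

    -- An earlier stage allows fewer moves, and whether a reply lies below a_i is independent of the
    -- stage.
    H-mono : ∀ {k P} (p : SΣ k P) {w j w' j' ρ ρ'} → K w j → K w' j' → j ≼ j' → H p w' j' ρ ρ' → H p w j ρ ρ'
    H-mono (𝐈.base _) k k' l h = h
    H-mono (𝐈.step _ q _) k k' l h i i≺ r r≺ ¬k =
      let k₁ = K-anti (≺+𝟙⇒≼ i≺) k
          k₂ = K-anti (≼-trans (≺+𝟙⇒≼ i≺) l) k'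
          (s , _ , ¬k' , h') = h i (≺-≼-trans i≺ (+𝟙-mono-≼ l)) r (¬K⇒≺ k₂ ¬k) ¬k
      in s , ¬K⇒≺ k₁ ¬k' , ¬k' , H-mono q k k' l h'

    -- Take a witness r for P at ρ, below some a_i. If P failed at ρ', every x would satisfy Q there
    -- while r does not, so inductively x and r are told apart at some stage. Compactness gives one
    -- stage for all x below a_i, yet H supplies a reply among them. The environments swap sides
    -- because the matrix is negated.
    truth : ∀ {k P} (p : SΣ k P) {ρ ρ'} → (∀ w j → K w j → H p w j ρ ρ') → P ρ → P ρ'
    truth (𝐈.base _) h = let (i , w , k , _) = K-cofinal 𝟘 in h w i k
    truth {P = P} (𝐈.step Q' q s) {ρ} {ρ'} h Pρ = dne λ ¬P' →
      let (r , ¬q) = proj₁ (s ρ) Pρ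
          (i , w₀ , k₀ , ¬k) = K-cofinal r
          (w , j , k , i≼j , none) = compactness (λ w j x → H q w j (x ∷ₑ ρ') (r ∷ₑ ρ))
            (⇑ (H-def q (v 0) (v 1) (v 2 ∷ᵗ cstᵉ ρ') (cst r ∷ᵗ cstᵉ ρ))) (H-mono q) w₀ k₀
            λ x _ → dne λ ¬e → ¬P' (proj₂ (s ρ') (x , λ Qx →
              ¬q (truth q (λ w j k → dne λ ¬H → ¬e (w , j , k , ¬H)) Qx)))
          (x , _ , ¬k' , hx) = h w j k i (≼⇒≺+𝟙 i≼j) r (¬K⇒≺ (K-anti i≼j k) ¬k) ¬k
      in none x (¬K⇒≺ k₀ ¬k') hx

    -- Codes of back-and-forth types

    bound : ℕ → M
    bound zero    = 𝟙 + 𝟙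
    -- A type one level up is a set of pairs (i, t) with i ≺ d and t ≺ `bound k`, coded by its bits.
    bound (suc k) = exp (d * bound k)

    -- The bits of c record which types t are realised by extending ρ with a point below a_i. Only
    -- bits with i at most j are prescribed, so ρ may have several codes.
    Type : ∀ {k P} → SΣ k P → M → M → M → Env → Set
    Type (𝐈.base {P} _) w j c ρ = c ≡ 𝟙 ↔ P ρ
    Type {suc k} (𝐈.step _ q _) w j c ρ = ∀ i → i ≺ j + 𝟙 → ∀ t → t ≺ bound k →
      Bit (i * bound k + t) c ↔ (Σ M λ r → r ≺ w × (¬ K r i × Type q w j t (r ∷ₑ ρ)))

    Type-def : ∀ {k P} (p : SΣ k P) {g h c L} → Tm g → Tm h → Tm c → EnvT L →
               Δ (λ η → Type p (g η) (h η) (c η) (L η))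
    Type-def (𝐈.base D) g h c l = Δ-↔ (Δ-≡ c (cst 𝟙)) (Δ-D₀ (𝐈.D₀-sub D l))
    Type-def {suc k} (𝐈.step _ q _) {g'} {h'} {c'} {L} g h c l =
      Δ-∀≺ {P = λ i η → ∀ t → t ≺ bound k → Bit (i * bound k + t) (c' η) ↔
              (Σ M λ r → r ≺ g' η × (¬ K r i × Type q (g' η) (h' η) t (r ∷ₑ L η)))} (h ⊹ cst 𝟙)
      (Δ-∀≺ {P = λ t η → Bit (η 0 * bound k + t) (c' (tail η)) ↔
              (Σ M λ r → r ≺ g' (tail η) × (¬ K r (η 0) × Type q (g' (tail η)) (h' (tail η)) t (r ∷ₑ L (tail η))))} (cst (bound k))
      (Δ-↔ (Δ-sub Δ-Bit ((v 1 ⊛ cst (bound k) ⊹ v 0) ∷ᵗ wk (wk c) ∷ᵗ drop 0))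
      (Δ-∃≺ {P = λ r η → ¬ K r (η 1) × Type q (g' (tail (tail η))) (h' (tail (tail η))) (η 0) (r ∷ₑ L (tail (tail η)))}
        (wk (wk g)) (Δ-× (Δ-¬ (K-def (v 0) (v 2)))
          (Type-def q (wk (wk (wk g))) (wk (wk (wk h))) (v 1) (v 0 ∷ᵗ wkᵉ (wkᵉ (wkᵉ l))))))))

    -- The points r that matter lie below a_i with i at most j, hence below any w that bounds a_j.
    Type-irrelevant : ∀ {k P} (p : SΣ k P) {w w' j c ρ} → K w j → K w' j → Type p w j c ρ → Type p w' j c ρ
    Type-irrelevant (𝐈.base _) k k' t = t
    Type-irrelevant (𝐈.step _ q _) {w} {w'} {j} {c} {ρ} k k' T i i≺ t t≺ =
      let (to , from) = T i i≺ t t≺ ; l = ≺+𝟙⇒≼ i≺ in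
        (λ b → let (r , _ , ¬k , T') = to b in
                 r , ¬K⇒≺ (K-anti l k') ¬k , ¬k , Type-irrelevant q k k' T')
      , (λ (r , _ , ¬k , T') → from (r , ¬K⇒≺ (K-anti l k) ¬k , ¬k , Type-irrelevant q k' k T'))

    -- Comprehension codes the realised pairs; indices of the cut are below d, so all of them fit
    -- below `d * bound k`.
    Type-exists : ∀ {k P} (p : SΣ k P) {w j} → K w j → ∀ ρ → Σ M λ c → c ≺ bound k × Type p w j c ρ
    Type-exists (𝐈.base {P} _) k ρ with em {P ρ}
    ... | yes Pρ = 𝟙 , x≺x+𝟙 𝟙 , (λ _ → Pρ) , (λ _ → refl)
    ... | no ¬Pρ = 𝟘 , <-trans _ _ _ zero<one (x≺x+𝟙 𝟙)
      , (λ e → ⊥-elim (<-irrefl 𝟘 (subst (𝟘 ≺_) (sym e) zero<one))) , λ Pρ → ⊥-elim (¬Pρ Pρ)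
    Type-exists {suc k} (𝐈.step _ q _) {w} {j} kw ρ =
      let (c , c≺ , h) = 𝐉.comprehension {λ p → Σ M λ i → i ≺ j + 𝟙 × (Σ M λ t → t ≺ bound k × (p ≡ i * bound k + t × Realised i t))}
            (⇑ (Δ-∃≺ {P = λ i η → Σ M λ t → t ≺ bound k × (η 0 ≡ i * bound k + t × Realised i t)} (cst (j + 𝟙))
              (Δ-∃≺ {P = λ t η → η 1 ≡ η 0 * bound k + t × Realised (η 0) t} (cst (bound k))
                (Δ-× (Δ-≡ (v 2) (v 1 ⊛ cst (bound k) ⊹ v 0))
                  (Δ-∃≺ {P = λ r η → ¬ K r (η 1) × Type q w j (η 0) (r ∷ₑ ρ)} (cst w)
                    (Δ-× (Δ-¬ (K-def (v 0) (v 2))) (Type-def q (cst w) (cst j) (v 1) (v 0 ∷ᵗ cstᵉ ρ))))))))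
            (d * bound k)
      in c , c≺ , λ i i≺ t t≺ →
        let (to , from) = h (i * bound k + t) (pair-bound (≼-≺-trans (≺+𝟙⇒≼ i≺) (K-bounded kw)) t≺) in
          (λ b → let (i' , _ , t' , t'≺ , e , R) = to b ; (i≡ , t≡) = quotient-unique t'≺ t≺ (sym e) in
                   subst (λ i → Realised i t) i≡ (subst (Realised i') t≡ R))
        , (λ R → from (i , i≺ , t , t≺ , refl , R))
      where
      Realised : M → M → Set
      Realised i t = Σ M λ r → r ≺ w × (¬ K r i × Type q w j t (r ∷ₑ ρ))

    -- To answer a move r, look up the type t of the extension by r: the shared code c says that t
    -- is also realised over ρ', and any point realising it is a reply.
    Type⇒H : ∀ {k P} (p : SΣ k P) {w j c ρ ρ'} → K w j → c ≺ bound k →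
             Type p w j c ρ → Type p w j c ρ' → H p w j ρ ρ'
    Type⇒H (𝐈.base _) k c≺ (_ , to-1) (from-1 , _) Pρ = from-1 (to-1 Pρ)
    Type⇒H (𝐈.step _ q _) {ρ = ρ} k c≺ T T' i i≺ r r≺ ¬k =
      let (t , t≺ , Tr) = Type-exists q k (r ∷ₑ ρ)
          (s , s≺ , ¬k' , Ts) = proj₁ (T' i i≺ t t≺) (proj₂ (T i i≺ t t≺) (r , r≺ , ¬k , Tr))
      in s , s≺ , ¬k' , Type⇒H q k t≺ Ts Tr

    -- Defining B from a code of its types

    module Definition {B : M → Set} (B-def : 𝐉.Δ (λ η → B (η 0))) {k : ℕ} {P : Env → Set} (p : SΣ k P) (ρ : Env)
                      (B↔P : ∀ x → B x ↔ P (x ∷ₑ ρ)) where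

      -- By `truth`, points on different sides of B are separated at some stage. Compactness makes
      -- the stage uniform first in x', then in x.
      transfers : ∀ {i w₀} → K w₀ i → Σ M λ w → Σ M λ j → K w j × i ≼ j ×
                  (∀ x → x ≺ w₀ → ∀ x' → x' ≺ w₀ → H p w j (x ∷ₑ ρ) (x' ∷ₑ ρ) → B x → B x')
      transfers {i} {w₀} k₀ =
        let (w , j , kw , i≼j , h) = compactness (λ w j x → Σ M λ x' → x' ≺ w₀ × Bad x w j x')
              (𝐉.Δ-∃≺ {P = λ x' η → Bad (η 2) (η 0) (η 1) x'} (cst w₀) (Bad-def (v 3) (v 1) (v 2) (v 0)))
              (λ k k' l (x' , l' , bad) → x' , l' , Bad-mono k k' l bad) w₀ k₀
              λ x _ → let (w , j , kw , _ , h) = compactness (Bad x) (Bad-def (cst x) (v 0) (v 1) (v 2)) Bad-mono w₀ k₀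
                                                  λ x' _ → defeated x x'
                      in w , j , kw , λ (x' , l , bad) → h x' l bad
        in w , j , kw , i≼j , λ x l x' l' hx Bx → dne λ ¬Bx' → h x l (x' , l' , hx , Bx , ¬Bx')
        where
        Bad : M → M → M → M → Set
        Bad x w j x' = H p w j (x ∷ₑ ρ) (x' ∷ₑ ρ) × (B x × ¬ B x')
        Bad-def : ∀ {f g h e} → Tm f → Tm g → Tm h → Tm e → 𝐉.Δ (λ η → Bad (f η) (g η) (h η) (e η))
        Bad-def f g h e = 𝐉.Δ-× (⇑ (H-def p g h (f ∷ᵗ cstᵉ ρ) (e ∷ᵗ cstᵉ ρ)))
          (𝐉.Δ-× (𝐉.Δ-sub B-def (f ∷ᵗ drop 0)) (𝐉.Δ-¬ (𝐉.Δ-sub B-def (e ∷ᵗ drop 0))))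
        Bad-mono : ∀ {x w j w' j' x'} → K w j → K w' j' → j ≼ j' → Bad x w' j' x' → Bad x w j x'
        Bad-mono k k' l (h , b) = H-mono p k k' l h , b
        defeated : ∀ x x' → Σ M λ w → Σ M λ j → K w j × ¬ Bad x w j x'
        defeated x x' = dne λ ¬e →
          let all : ∀ w j → K w j → Bad x w j x'
              all w j kw = dne λ ¬bad → ¬e (w , j , kw , ¬bad)
              (_ , Bx , ¬Bx') = all w₀ i k₀
          in ¬Bx' (proj₂ (B↔P x') (truth p (λ w j kw → proj₁ (all w j kw)) (proj₁ (B↔P x) Bx)))

      private
        D : M
        D = bound k

      code : M → M → M → M
      code i j c = (i * d + j) * D + c

      -- w only certifies that a_i and a_j exist: the conditions In and Out below do not
      -- depend on its choice.
      Coded : (M → M → M → M → Set) → M → Set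
      Coded G z = Σ M λ w → Σ M λ i → Σ M λ j → Σ M λ c → z ≡ code i j c × (K w i × (K w j × (c ≺ D × G w i j c)))

      Coded-def : ∀ {G} → 𝐉.Δ (λ η → G (η 3) (η 2) (η 1) (η 0)) → 𝐉.SΣ 𝐉.N (λ η → Coded G (η 0))
      Coded-def {G} G-def =
        𝐉.∃-clN {P = λ w η → Σ M λ i → Σ M λ j → Σ M λ c → η 0 ≡ code i j c × (K w i × (K w j × (c ≺ D × G w i j c)))}
        (𝐉.∃-clN {P = λ i η → Σ M λ j → Σ M λ c → η 1 ≡ code i j c × (K (η 0) i × (K (η 0) j × (c ≺ D × G (η 0) i j c)))}
        (𝐉.∃-clN {P = λ j η → Σ M λ c → η 2 ≡ code (η 0) j c × (K (η 1) (η 0) × (K (η 1) j × (c ≺ D × G (η 1) (η 0) j c)))}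
        (𝐉.∃-clN {P = λ c η → η 3 ≡ code (η 1) (η 0) c × (K (η 2) (η 1) × (K (η 2) (η 0) × (c ≺ D × G (η 2) (η 1) (η 0) c)))}
        (𝐉.Δ⇒Σ (𝐉.Δ-× (𝐉.Δ-≡ (v 4) ((v 2 ⊛ cst d ⊹ v 1) ⊛ cst D ⊹ v 0)) (𝐉.Δ-× (⇑ (K-def (v 3) (v 2)))
          (𝐉.Δ-× (⇑ (K-def (v 3) (v 1))) (𝐉.Δ-× (𝐉.Δ-≺ (v 0) (cst D)) G-def))))))))

      In Out : M → M → M → M → Set
      In  w i j c = ∀ x → x ≺ w → ¬ K x i → Type p w j c (x ∷ₑ ρ) → B x
      Out w i j c = Σ M λ x → x ≺ w × (¬ K x i × (Type p w j c (x ∷ₑ ρ) × ¬ B x))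

      private
        Type-def' : 𝐉.Δ (λ η → Type p (η 4) (η 2) (η 1) (η 0 ∷ₑ ρ))
        Type-def' = ⇑ (Type-def p (v 4) (v 2) (v 1) (v 0 ∷ᵗ cstᵉ ρ))

        ¬K-def' : 𝐉.Δ (λ η → ¬ K (η 0) (η 3))
        ¬K-def' = ⇑ (Δ-¬ (K-def (v 0) (v 3)))

      In-def : 𝐉.Δ (λ η → In (η 3) (η 2) (η 1) (η 0))
      In-def = 𝐉.Δ-∀≺ {P = λ x η → ¬ K x (η 2) → Type p (η 3) (η 1) (η 0) (x ∷ₑ ρ) → B x} (v 3)
        (𝐉.Δ-→ ¬K-def' (𝐉.Δ-→ Type-def' B-def))

      Out-def : 𝐉.Δ (λ η → Out (η 3) (η 2) (η 1) (η 0))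
      Out-def = 𝐉.Δ-∃≺ {P = λ x η → ¬ K x (η 2) × (Type p (η 3) (η 1) (η 0) (x ∷ₑ ρ) × ¬ B x)} (v 3)
        (𝐉.Δ-× ¬K-def' (𝐉.Δ-× Type-def' (𝐉.Δ-¬ B-def)))

      -- Decoding z yields the same i, j and c for both; a point that witnesses `Out` then
      -- contradicts `In`, once its type is moved to the other bound.
      disjoint : ∀ z → Coded In z → ¬ Coded Out z
      disjoint z (w , i , j , c , e , ki , kj , c≺ , h) (w' , i' , j' , c' , e' , ki' , kj' , c'≺ , x , x≺ , ¬k , T , ¬Bx)
        with quotient-unique c≺ c'≺ (trans (sym e) e')
      ... | e₁ , refl with quotient-unique (K-bounded kj) (K-bounded kj') e₁
      ...   | refl , refl = ¬Bx (h x (¬K⇒≺ ki ¬k) ¬k (Type-irrelevant p kj' kj T))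

      definable : SΣ 𝐈.N (λ η → B (η 0))
      definable = 𝐈.resp (λ η → from (η 0) , to (η 0)) B'-def
        where
        -- Membership of i and j in the cut is given only in Σ form, so separation is used in place
        -- of comprehension. It decides every code whose indices lie in the cut.
        separated = 𝐉.separation (Coded-def {In} In-def) (Coded-def {Out} Out-def) disjoint (d * d * D)
        F : M
        F = proj₁ separated
        Known : M → M → M → M → M → Set
        Known x w i j c = K w i × (K w j × (¬ K x i × (c ≺ D × (Type p w j c (x ∷ₑ ρ) × Bit (code i j c) F))))
        B' : M → Set
        B' x = Σ M λ w → Σ M λ i → Σ M λ j → Σ M λ c → Known x w i j c
        B'-def : SΣ 𝐈.N (λ η → B' (η 0))
        B'-def =
          𝐈.∃-clN {P = λ w η → Σ M λ i → Σ M λ j → Σ M λ c → Known (η 0) w i j c}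
          (𝐈.∃-clN {P = λ i η → Σ M λ j → Σ M λ c → Known (η 1) (η 0) i j c}
          (𝐈.∃-clN {P = λ j η → Σ M λ c → Known (η 2) (η 1) (η 0) j c}
          (𝐈.∃-clN {P = λ c η → Known (η 3) (η 2) (η 1) (η 0) c}
          (𝐈.Δ⇒Σ (Δ-× (K-def (v 3) (v 2)) (Δ-× (K-def (v 3) (v 1)) (Δ-× (Δ-¬ (K-def (v 4) (v 2)))
            (Δ-× (Δ-≺ (v 0) (cst D)) (Δ-× (Type-def p (v 3) (v 1) (v 0) (v 4 ∷ᵗ cstᵉ ρ))
              (Δ-sub Δ-Bit (((v 2 ⊛ cst d ⊹ v 1) ⊛ cst D ⊹ v 0) ∷ᵗ cst F ∷ᵗ drop 0)))))))))))
        code-bound : ∀ {w i j c} → K w i → K w j → c ≺ D → code i j c ≺ d * d * D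
        code-bound ki kj c≺ = pair-bound (pair-bound (K-bounded ki) (K-bounded kj)) c≺
        from : ∀ x → B' x → B x
        from x (w , i , j , c , ki , kj , ¬k , c≺ , T , b) = dne λ ¬Bx →
          proj₂ (proj₂ separated _ (code-bound ki kj c≺))
            (w , i , j , c , refl , ki , kj , c≺ , x , ¬K⇒≺ ki ¬k , ¬k , T , ¬Bx) b
        to : ∀ x → B x → B' x
        to x Bx =
          -- Choose i with x below a_i, then a stage j that is uniform for a_i. Every point below
          -- a_i sharing the type of x at stage j lies in B, so F lists that type.
          let (i , w₀ , k₀ , ¬k) = K-cofinal x
              (w , j , kj , i≼j , h) = transfers k₀
              ki = K-anti i≼j kj
              (c , c≺ , T) = Type-exists p kj (x ∷ₑ ρ)
          in w , i , j , c , ki , kj , ¬k , c≺ , T ,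
             proj₁ (proj₂ separated _ (code-bound ki kj c≺))
               (w , i , j , c , refl , ki , kj , c≺ , λ x' _ ¬k' T' →
                 h x (¬K⇒≺ k₀ ¬k) x' (¬K⇒≺ k₀ ¬k') (Type⇒H p kj c≺ T T') Bx)

theorem4p2 : ExcludedMiddle 0ℓ →
  (n : ℕ) (𝕄 : Structure) (A B : Structure.Carrier 𝕄 → Set) →
  Semantics.ModelsBΣ+exp 𝕄 n A B →
  Semantics.IΣ-fails 𝕄 n A →
  Semantics.ArithDefinable 𝕄 A B →
  Semantics.Δ⁰-Definable 𝕄 (suc n) A B
theorem4p2 em n 𝕄 A B (pm , ind₀ , bs , exponential) (θ , θΣ , τ , θ-fails) (φ , ρ , φ-def) =
  let (σ , σΣ , ρ₁ , h) = realizeΣ B-Σ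
      (π , πΠ , ρ₂ , g) = realizeΠ ¬B-Σ
  in (fsub id fuse σ , fsub-Σ id fuse σΣ , ρ₁ , λ m → ↔-trans (h (m ∷ₑ ρ₁)) (fused σ ρ₁ m))
   -- The Π definition of B is the negated Σ definition of its complement.
   , (fsub id fuse π , fsub-Π id fuse πΠ , ρ₂ , λ m → ↔-trans ¬¬-↔ (↔-trans (g (m ∷ₑ ρ₂)) (fused π ρ₂ m)))
  where
  open Logic em
  open Structure 𝕄 using (𝟘; 𝟙) renaming (Carrier to M; _⊕_ to infixl 6 _+_)
  open Semantics 𝕄 renaming (_∷ₑ_ to infixr 5 _∷ₑ_; _↔_ to infix 0 _↔_)
  open Definability em 𝕄 pm
  open Class (predA A)

  IJ : ∀ p x → predA A p x ↔ predAB A B true x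
  IJ _ _ = ↔-refl

  bsA : BΣ-scheme (suc n) (predA A)
  bsA = Transfer.BΣ-pull (predA A) (predAB A B) (λ _ → true) IJ (suc n) bs

  open Bounding n bsA using (N; ofΣ; ¬¬-↔)

  -- `Defines` evaluates at `m ∷ₑ ρ`, so the separate parameter positions are folded back behind the
  -- single variable.
  fuse : ℕ → Term
  fuse = var ⋈ (var ∘ suc)

  fused : ∀ ψ ρ m → Sat (predA A) ψ ((m ∷ₑ ρ) ⋈ ρ) ↔ Sat (predA A) (fsub id fuse ψ) (m ∷ₑ ρ)
  fused ψ ρ m = Sat-fsub (λ _ _ → ↔-refl) ψ (⟦⋈⟧ (λ _ → refl) (λ _ → refl))

  V : M → Set
  V x = Sat (predA A) θ (x ∷ₑ τ)

  -- If a premise of the failing induction instance were false, the instance would hold vacuously.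
  V-zero : V 𝟘
  V-zero = dne λ ¬V₀ → θ-fails λ V₀ → ⊥-elim (¬V₀ V₀)

  V-suc : ∀ x → V x → V (x + 𝟙)
  V-suc = dne λ ¬Vs → θ-fails λ _ Vs → ⊥-elim (¬Vs Vs)

  V-fails : Σ M λ d → ¬ V d
  V-fails = dne λ all → θ-fails λ _ _ x → dne λ ¬Vx → all (x , ¬Vx)

  -- Stated for any C because it is applied to B and to its complement.
  definable : SΣ N (Sat (predA A) θ) → ∀ {C} → Class.Bounding.Δ (predAB A B) n bs (λ η → C (η 0)) → ∀ {k P} → SΣ k P →
              (∀ x → C x ↔ P (x ∷ₑ ρ)) → SΣ N (λ η → C (η 0))
  definable (step Q q s) C-def p =
    let (d , ¬Vd) = V-fails
        to = λ x → proj₁ (s (x ∷ₑ τ)) ; from = λ x → proj₂ (s (x ∷ₑ τ))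
        open Interpretation (predA A) (predAB A B) (λ _ → true) IJ n ind₀ bs exponential
               (λ w x → Q w (x ∷ₑ τ)) (q [ v 0 ∷ᵗ v 1 ∷ᵗ cstᵉ τ ]) d
               (to 𝟘 V-zero) (λ x → to (x + 𝟙) ∘ V-suc x ∘ from x) (¬Vd ∘ from d)
    in Definition.definable C-def p ρ

  module AB = Class (predAB A B)
  module BoundingAB = AB.Bounding n bs

  B-Δ : BoundingAB.Δ (λ η → B (η 0))
  B-Δ = BoundingAB.Δ-D₀ (AB.D₀-rel false (v 0))

  θ-Σ : SΣ N (Sat (predA A) θ)
  θ-Σ = ofΣ ℕₚ.≤-refl θΣ

  B-Σ : SΣ N (λ η → B (η 0))
  B-Σ = definable θ-Σ {B} B-Δ (proj₂ (ar-Sat φ)) φ-def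

  ¬B-Σ : SΣ N (λ η → ¬ B (η 0))
  ¬B-Σ = definable θ-Σ {λ x → ¬ B x} (BoundingAB.Δ-¬ B-Δ) (proj₂ (ar-¬ (ar-Sat φ))) λ x → ¬-cong (φ-def x)
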